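{- Let $p$ be an odd prime and $k\in\mathbb{N}$ with $2\le k\le\frac{p-1}{2}$ such that $p>2k+1$ and $p\equiv 1\pmod{2k}$. Suppose $n\in\{\frac{p-1}{k}+1,\frac{p-1}{k}+2,\ldots,\frac{2(p-1)}{k}-1\}$ is odd and $d\in\mathbb{Z}$ satisfies $\chi_k(d)=1$. (a) If $k$ is even, then $\left(\frac{S_{n,k}(d,p)}{p}\right)\neq -1$. (b) If $k$ is odd, then $$\left(\frac{S_{n,k}(d,p)}{p}\right)\neq\begin{cases}-1, & \text{if } p\equiv 1\pmod{4k};\\ \left(\frac{d}{p}\right), & \text{if } p\equiv 2k+1\pmod{4k}.\end{cases}$$
   Context: For an odd prime $p$ and an integer $k\ge 2$ with $k\mid p-1$, let $\alpha_1,\ldots,\alpha_{(p-1)/k}$ be integers representing the distinct (nonzero) $k$-th power residues modulo $p$. For $n\in\mathbb{N}$ and $d\in\mathbb{Z}$, $$S_{n,k}(d,p)=\det\left[(\alpha_i+d\,\alpha_j)^n\right]_{1\le i,j\le \frac{p-1}{k}}.$$ $\chi_k$ denotes a multiplicative character of order $k$ modulo $p$; the condition $\chi_k(d)=1$ is equivalent to $d^{(p-1)/k}\equiv 1\pmod p$. $\left(\frac{\cdot}{p}\right)$ is the Legendre symbol. -}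

module Defs where

import Algebra.Properties.Semiring.Sum as Sum
open import Data.Fin.Base using (Fin; zero; suc; toℕ; punchIn)
open import Data.Fin.Properties using (any?)
open import Data.Integer.Base using (ℤ; +_; -_; -1ℤ; 0ℤ; 1ℤ; _+_; _-_; _*_; _^_)
open import Data.Integer.Divisibility.Signed using (_∣_; _∣?_)
open import Data.Integer.Properties using (+-*-semiring)
open import Data.Maybe.Base using (Maybe; just; nothing; map; zipWith)
open import Data.Maybe.Relation.Binary.Pointwise using (Pointwise)
open import Data.Nat.Base as ℕ using (ℕ; zero; suc; NonZero; _∸_; _/_)
open import Data.Product.Base using (∃; ∃-syntax; _×_)
open import Function.Bundles using (_⇔_)
open import Relation.Binary.PropositionalEquality.Core using (_≡_)
open import Relation.Nullary.Decidable.Core using (yes; no)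
open import Relation.Nullary.Negation.Core using (¬_)

private
  module ℤΣ = Sum +-*-semiring

infix 4 _≡_[mod_]

_≡_[mod_] : ℤ → ℤ → ℕ → Set
a ≡ b [mod m ] = + m ∣ a - b

Matrix : ℕ → Set
Matrix m = Fin m → Fin m → ℤ

-- Laplace expansion along the first row.
det : ∀ {m} → Matrix m → ℤ
det {zero}  A = 1ℤ
det {suc m} A = ℤΣ.sum λ j →
  -1ℤ ^ toℕ j * A zero j * det (λ i l → A (suc i) (punchIn j l))

-- It suffices to look for a square root among 0, …, p − 1.
legendre : ℤ → ℕ → ℤ
legendre a p with + p ∣? a
... | yes _ = 0ℤ
... | no  _ with any? {n = p} (λ x → + p ∣? ((+ toℕ x) ^ 2 - a))
...   | yes _ = 1ℤ
...   | no  _ = -1ℤ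

IsNonzeroPowerResidue : (k p : ℕ) → ℤ → Set
IsNonzeroPowerResidue k p a = ¬ (+ p ∣ a) × ∃[ x ] (x ^ k ≡ a [mod p ])

record RepresentsPowerResidues (k p : ℕ) .{{_ : NonZero k}}
                               (α : Fin ((p ∸ 1) / k) → ℤ) : Set where
  field
    residue  : ∀ i → IsNonzeroPowerResidue k p (α i)
    distinct : ∀ i j → α i ≡ α j [mod p ] → i ≡ j
    complete : ∀ a → IsNonzeroPowerResidue k p a → ∃[ i ] (α i ≡ a [mod p ])

S : (n k : ℕ) (d : ℤ) (p : ℕ) .{{_ : NonZero k}} → (Fin ((p ∸ 1) / k) → ℤ) → ℤ
S n k d p α = det λ i j → (α i + d * α j) ^ n

-- The values of a complex multiplicative character modulo p are 0 and
-- N-th roots of unity, where N = p − 1.  The value exp(2πi e/N) is encoded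
-- as `just e`, the exponent e being taken modulo N, and the value 0 as
-- `nothing`.
Value : Set
Value = Maybe ℤ

infix 4 _≈_[ζ_]

_≈_[ζ_] : Value → Value → ℕ → Set
u ≈ v [ζ N ] = Pointwise (λ e f → e ≡ f [mod N ]) u v

0ᵛ 1ᵛ : Value
0ᵛ = nothing
1ᵛ = just 0ℤ

infixl 7 _·_
infixr 8 _^ᵛ_

_·_ : Value → Value → Value
_·_ = zipWith _+_

-- Only used on nonzero values or with positive exponent: 0 ^ᵛ 0 is 0 here.
_^ᵛ_ : Value → ℕ → Value
u ^ᵛ j = map (+ j *_) u

record IsCharacter (p : ℕ) (χ : ℤ → Value) : Set where
  field
    periodic       : ∀ a b → a ≡ b [mod p ] → χ a ≈ χ b [ζ p ∸ 1 ]
    vanishing      : ∀ a → χ a ≈ 0ᵛ [ζ p ∸ 1 ] ⇔ + p ∣ a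
    multiplicative : ∀ a b → χ (a * b) ≈ χ a · χ b [ζ p ∸ 1 ]

IsPowerTrivial : (p : ℕ) → (ℤ → Value) → ℕ → Set
IsPowerTrivial p χ j = ∀ a → ¬ (+ p ∣ a) → χ a ^ᵛ j ≈ 1ᵛ [ζ p ∸ 1 ]

record HasOrder (p : ℕ) (χ : ℤ → Value) (k : ℕ) : Set where
  field
    positive : 1 ℕ.≤ k
    trivial  : IsPowerTrivial p χ k
    minimal  : ∀ j → 1 ℕ.≤ j → IsPowerTrivial p χ j → k ℕ.≤ j

{-# OPTIONS --safe #-}

-- Let m = (p − 1)/k, which is even, and let H be the group of the m nonzero
-- k-th power residues.  Both d and −1 lie in H, and so does c = −d.  Since
-- αᵢ + d αⱼ = αᵢ − c αⱼ, the matrix of S arises from the skew-symmetric matrix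
-- (αᵢ − αⱼ)ⁿ, n odd, by permuting its columns as multiplication by c permutes H.
-- A skew-symmetric determinant of even order is a square modulo p.  Applied to
-- the Vandermonde matrix, the same permutation of columns is a scaling of the
-- rows, so its sign is c^(m(m−1)/2).  Hence S · c^(m/2) is a square modulo p,
-- and it remains to decide whether c^(m/2) is one.
module Submission where

open import Defs

-- Cyclicity of the unit group is never invoked; counting and Vandermonde determinants replace it.
-- Why d lies in H: the exponents of the values of χ form a group generated by a divisor of p - 1,
-- and order k forces this divisor to be m. If g has exponent m, the products αᵢ gʲ with j < k are
-- pairwise incongruent, so they exhaust the nonzero classes, and χ takes the value 1 only on those
-- with j = 0. Why -1 lies in H: with h = m/2, every a in H has aʰ ≡ ±1, and aʰ ≡ 1 throughout H
-- would make a nonsingular Vandermonde matrix singular. Whether cʰ is a square: since p - 1 = 2kh,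
-- the two classes of p modulo 4k are the two parities of h. For even k already c is a square; for
-- even h so is cʰ. If k and h are odd, -1 is not a square, S · (-d) is one, and so is one of d, -d,
-- which separates the symbols of S and d. S may be divisible by p, so only one value of its symbol
-- is excluded. Skew determinants are treated by elimination: free of division over ℤ, with the
-- powers of the pivot cancelled modulo p.

module _ where

  import Algebra.Properties.CommutativeMonoid.Sum as CMSum
  import Algebra.Properties.Semiring.Sum as SemiringSum
  open import Data.Empty using (⊥-elim)
  open import Data.Fin.Base using (Fin; zero; suc; toℕ; fromℕ<; inject₁; punchIn; remQuot; combine)
  open import Data.Fin.Permutation using (Permutation′; permutation; _⟨$⟩ʳ_) renaming (transpose to transposition)
  open import Data.Fin.Permutation.Components using (transpose; transpose-inverse)
  open import Data.Fin.Permutation.Transposition.List using (TranspositionList; eval; decompose; eval-decompose)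
  open import Data.Fin.Properties using (_≟_; any?; suc-injective; 0≢1+n; toℕ-fromℕ<;
    toℕ-inject₁; toℕ-injective; toℕ<n; fromℕ<-injective; pigeonhole; combine-remQuot)
  open import Data.Integer.Base using (ℤ; +_; -[1+_]; -_; -1ℤ; 0ℤ; 1ℤ; _+_; _-_; _*_; _^_) renaming (∣_∣ to abs)
  open import Data.Integer.DivMod using (_%ℕ_; _/ℕ_; a≡a%ℕn+[a/ℕn]*n; n%ℕd<d)
  open import Data.Integer.Divisibility.Signed using (_∣_; _∣?_; divides; ∣⇒∣ᵤ; ∣ᵤ⇒∣; ∣-refl; ∣-trans;
    ∣m∣n⇒∣m+n; ∣m⇒∣-m; ∣n⇒∣m*n; ∣m⇒∣m*n; *-cancelʳ-∣)
  open import Data.Integer.Properties using (+-*-semiring; *-1-commutativeMonoid; *-identityˡ; *-identityʳ; *-zeroʳ; *-zeroˡ; *-comm; *-assoc;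
    +-identityʳ; +-identityˡ; +-injective; abs-*; pos-*; ^-distribˡ-+-*; ^-*-assoc; ^-zeroˡ;
    m-n≡m⊖n; ⊖-≥; ∣m⊝n∣≤m⊔n; ∣i∣≡0⇒i≡0; i-j≡0⇒i≡j)
  open import Data.Integer.Tactic.RingSolver using (solve-∀)
  open import Data.List.Base using ([]; _∷_)
  open import Data.Maybe.Base using (just; nothing)
  open import Data.Maybe.Relation.Binary.Pointwise using (just; nothing)
  open import Data.Nat.Base as ℕ using (ℕ; zero; suc; s≤s; z≤n; _∸_)
  import Data.Nat.Divisibility as ℕ∣
  import Data.Nat.Properties as ℕ
  open import Data.Nat.GCD using (module Bézout; module GCD)
  open import Data.Nat.Primality using (Prime; euclidsLemma; prime⇒irreducible; prime⇒nonZero; prime⇒nonTrivial)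
  open import Data.Product.Base using (∃-syntax; _×_; _,_; proj₁; proj₂)
  open import Data.Sum.Base as Sum using (_⊎_; inj₁; inj₂; [_,_]′)
  open import Function.Base using (_∘_)
  open import Function.Bundles using (Equivalence)
  open import Relation.Binary.Bundles using (Setoid)
  open import Relation.Binary.PropositionalEquality
  import Relation.Binary.Reasoning.Setoid as SetoidReasoning
  open import Relation.Nullary using (Dec; yes; no; ¬_; ¬?)
  open import Relation.Nullary.Decidable using (decidable-stable)

  open SemiringSum +-*-semiring using (sum; sum-cong-≗; sum-replicate-zero; *-distribˡ-sum; ∑-comm)
  open CMSum *-1-commutativeMonoid using () renaming (sum to prod; sum-remove to prod-remove; sum-permute to prod-permute)

  private variable
    m : ℕ

  module _ where

    -- Determinants of integer matrices

    open ≡-Reasoning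

    sum-zero : (f : Fin m → ℤ) → (∀ j → f j ≡ 0ℤ) → sum f ≡ 0ℤ
    sum-zero {m} f f≗0 = trans (sum-cong-≗ f≗0) (sum-replicate-zero m)

    sum-linear : ∀ x y (f g h : Fin m → ℤ) → (∀ j → f j ≡ x * g j + y * h j) →
                 sum f ≡ x * sum g + y * sum h
    sum-linear {zero}  x y f g h f≗ = lemma x y
      where
      lemma : ∀ x y → 0ℤ ≡ x * 0ℤ + y * 0ℤ
      lemma = solve-∀
    sum-linear {suc m} x y f g h f≗ =
      trans (cong₂ _+_ (f≗ zero) (sum-linear x y (f ∘ suc) (g ∘ suc) (h ∘ suc) (f≗ ∘ suc)))
            (lemma x y (g zero) (h zero) (sum (g ∘ suc)) (sum (h ∘ suc)))
      where
      lemma : ∀ x y a b c d → (x * a + y * b) + (x * c + y * d) ≡ x * (a + c) + y * (b + d)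
      lemma = solve-∀

    minor : Matrix (suc m) → Fin (suc m) → Matrix m
    minor A j i l = A (suc i) (punchIn j l)

    infixl 9 _ᵀ
    _ᵀ : Matrix m → Matrix m
    (A ᵀ) i j = A j i

    det-cong : {A B : Matrix m} → (∀ i j → A i j ≡ B i j) → det A ≡ det B
    det-cong {zero}  A≗B = refl
    det-cong {suc m} A≗B = sum-cong-≗ λ j →
      cong₂ _*_ (cong (-1ℤ ^ toℕ j *_) (A≗B zero j)) (det-cong λ i l → A≗B (suc i) (punchIn j l))

    doubleMinor : Matrix (suc (suc m)) → Fin (suc m) → Fin (suc m) → Matrix m
    doubleMinor A i j r c = A (suc (punchIn i r)) (suc (punchIn j c))

    -- Deleting row 0 and column j + 1 gives the sign (-1)^(j+1), deleting row i + 1 and column 0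
    -- afterwards gives (-1)^i; the leading minus is the odd factor left over.
    borderTerm : Matrix (suc (suc m)) → Fin (suc m) → Fin (suc m) → ℤ
    borderTerm A i j =
      - (-1ℤ ^ toℕ j * -1ℤ ^ toℕ i * (A zero (suc j) * A (suc i) zero) * det (doubleMinor A i j))

    -- `det-border` transposes minors of size m + 1 and, inside them, minors of size m, so `detᵀ` is
    -- an induction that needs two smaller sizes at once.
    TransposeInvariant : ℕ → Set
    TransposeInvariant m = (A : Matrix m) → det (A ᵀ) ≡ det A

    -- Cauchy's expansion along the first row and the first column, visibly
    -- symmetric under transposition.
    det-border : TransposeInvariant m → TransposeInvariant (suc m) → (A : Matrix (suc (suc m))) →
      det A ≡ A zero zero * det (minor A zero) + sum λ j → sum λ i → borderTerm A i j
    det-border {m} inv inv⁺ A = cong₂ _+_ (cong (_* det (minor A zero)) (*-identityˡ (A zero zero))) (sum-cong-≗ step)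
      where
      lemma : ∀ s a t b d → (-1ℤ * s * a) * (t * b * d) ≡ - (s * t * (a * b) * d)
      lemma = solve-∀
      step : ∀ j → -1ℤ ^ toℕ (suc j) * A zero (suc j) * det (minor A (suc j)) ≡ sum (λ i → borderTerm A i j)
      step j = begin
        x * det (minor A (suc j))            ≡⟨ cong (x *_) (inv⁺ (minor A (suc j))) ⟨
        x * det (minor A (suc j) ᵀ)          ≡⟨ *-distribˡ-sum x (λ i → -1ℤ ^ toℕ i * A (suc i) zero * det (minor (minor A (suc j) ᵀ) i)) ⟩
        sum (λ i → x * (-1ℤ ^ toℕ i * A (suc i) zero * det (minor (minor A (suc j) ᵀ) i)))
          ≡⟨ sum-cong-≗ (λ i → trans
               (cong (λ z → x * (-1ℤ ^ toℕ i * A (suc i) zero * z)) (inv (doubleMinor A i j)))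
               (lemma (-1ℤ ^ toℕ j) (A zero (suc j)) (-1ℤ ^ toℕ i) (A (suc i) zero) (det (doubleMinor A i j)))) ⟩
        sum (λ i → borderTerm A i j) ∎
        where x = -1ℤ ^ toℕ (suc j) * A zero (suc j)

    detᵀ : TransposeInvariant m
    detᵀ {zero}        A = refl
    detᵀ {suc zero}    A = refl
    detᵀ {suc (suc m)} A = begin
      det (A ᵀ) ≡⟨ det-border detᵀ detᵀ (A ᵀ) ⟩
      A zero zero * det (minor A zero ᵀ) + sum (λ j → sum λ i → borderTerm (A ᵀ) i j)
        ≡⟨ cong₂ _+_ (cong (A zero zero *_) (detᵀ (minor A zero)))
                     (trans (sum-cong-≗ λ j → sum-cong-≗ λ i → flip-term i j)
                            (∑-comm (λ j i → borderTerm A j i))) ⟩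
      A zero zero * det (minor A zero) + sum (λ i → sum λ j → borderTerm A j i) ≡⟨ det-border detᵀ detᵀ A ⟨
      det A ∎
      where
      lemma : ∀ s t a b d → - (s * t * (a * b) * d) ≡ - (t * s * (b * a) * d)
      lemma = solve-∀
      flip-term : ∀ i j → borderTerm (A ᵀ) i j ≡ borderTerm A j i
      flip-term i j = trans
        (cong (λ d → - (-1ℤ ^ toℕ j * -1ℤ ^ toℕ i * (A (suc j) zero * A zero (suc i)) * d)) (detᵀ (doubleMinor A j i)))
        (lemma (-1ℤ ^ toℕ j) (-1ℤ ^ toℕ i) (A (suc j) zero) (A zero (suc i)) (det (doubleMinor A j i)))

    -- Multilinearity and alternation in the rows

    AgreeOff : Fin m → Matrix m → Matrix m → Set
    AgreeOff i A B = ∀ r → r ≢ i → ∀ l → A r l ≡ B r l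

    det-linear : ∀ i x y (A B C : Matrix m) → (∀ l → A i l ≡ x * B i l + y * C i l) →
                 AgreeOff i A B → AgreeOff i A C → det A ≡ x * det B + y * det C
    det-linear {suc m} zero x y A B C Aᵢ A~B A~C = sum-linear x y _ _ _ λ j → begin
      -1ℤ ^ toℕ j * A zero j * det (minor A j)
        ≡⟨ cong (λ a → -1ℤ ^ toℕ j * a * det (minor A j)) (Aᵢ j) ⟩
      -1ℤ ^ toℕ j * (x * B zero j + y * C zero j) * det (minor A j)
        ≡⟨ lemma x y (-1ℤ ^ toℕ j) (B zero j) (C zero j) (det (minor A j)) ⟩
      x * (-1ℤ ^ toℕ j * B zero j * det (minor A j)) + y * (-1ℤ ^ toℕ j * C zero j * det (minor A j))
        ≡⟨ cong₂ (λ b c → x * (-1ℤ ^ toℕ j * B zero j * b) + y * (-1ℤ ^ toℕ j * C zero j * c))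
             (det-cong λ i l → A~B (suc i) (λ ()) (punchIn j l))
             (det-cong λ i l → A~C (suc i) (λ ()) (punchIn j l)) ⟩
      x * (-1ℤ ^ toℕ j * B zero j * det (minor B j)) + y * (-1ℤ ^ toℕ j * C zero j * det (minor C j)) ∎
      where
      lemma : ∀ x y s b c d → s * (x * b + y * c) * d ≡ x * (s * b * d) + y * (s * c * d)
      lemma = solve-∀
    det-linear {suc m} (suc i) x y A B C Aᵢ A~B A~C = sum-linear x y _ _ _ λ j → begin
      -1ℤ ^ toℕ j * A zero j * det (minor A j)
        ≡⟨ cong (-1ℤ ^ toℕ j * A zero j *_)
             (det-linear i x y (minor A j) (minor B j) (minor C j) (λ l → Aᵢ (punchIn j l))
               (λ r r≢i l → A~B (suc r) (r≢i ∘ suc-injective) (punchIn j l))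
               (λ r r≢i l → A~C (suc r) (r≢i ∘ suc-injective) (punchIn j l))) ⟩
      -1ℤ ^ toℕ j * A zero j * (x * det (minor B j) + y * det (minor C j))
        ≡⟨ lemma x y (-1ℤ ^ toℕ j) (A zero j) (det (minor B j)) (det (minor C j)) ⟩
      x * (-1ℤ ^ toℕ j * A zero j * det (minor B j)) + y * (-1ℤ ^ toℕ j * A zero j * det (minor C j))
        ≡⟨ cong₂ (λ b c → x * (-1ℤ ^ toℕ j * b * det (minor B j)) + y * (-1ℤ ^ toℕ j * c * det (minor C j)))
             (A~B zero (λ ()) j) (A~C zero (λ ()) j) ⟩
      x * (-1ℤ ^ toℕ j * B zero j * det (minor B j)) + y * (-1ℤ ^ toℕ j * C zero j * det (minor C j)) ∎
      where
      lemma : ∀ x y s a b c → s * a * (x * b + y * c) ≡ x * (s * a * b) + y * (s * a * c)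
      lemma = solve-∀

    -- In the expansion along row 0 the first two terms have equal minors and opposite signs. Every
    -- other minor keeps both equal columns, again as its first two, so induction applies.
    det-column₀₁ : (A : Matrix (suc (suc m))) → (∀ i → A i zero ≡ A i (suc zero)) → det A ≡ 0ℤ
    det-column₀₁ {m} A A₀≗A₁ = begin
      1ℤ * A zero zero * det (minor A zero) + (-1ℤ * 1ℤ * A zero (suc zero) * det (minor A (suc zero)) + sum rest)
        ≡⟨ cong₂ (λ a b → 1ℤ * a * b + (-1ℤ * 1ℤ * A zero (suc zero) * det (minor A (suc zero)) + sum rest))
             (A₀≗A₁ zero) (det-cong minors) ⟩
      1ℤ * A zero (suc zero) * det (minor A (suc zero)) + (-1ℤ * 1ℤ * A zero (suc zero) * det (minor A (suc zero)) + sum rest)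
        ≡⟨ lemma (A zero (suc zero)) (det (minor A (suc zero))) (sum rest) ⟩
      sum rest ≡⟨ sum-zero rest (rest-zero A A₀≗A₁) ⟩
      0ℤ ∎
      where
      lemma : ∀ a b c → 1ℤ * a * b + (-1ℤ * 1ℤ * a * b + c) ≡ c
      lemma = solve-∀
      rest : Fin m → ℤ
      rest j = -1ℤ ^ toℕ (suc (suc j)) * A zero (suc (suc j)) * det (minor A (suc (suc j)))
      minors : ∀ i l → minor A zero i l ≡ minor A (suc zero) i l
      minors i zero    = sym (A₀≗A₁ (suc i))
      minors i (suc l) = refl
      rest-zero : ∀ {m} (A : Matrix (suc (suc m))) → (∀ i → A i zero ≡ A i (suc zero)) → ∀ (j : Fin m) →
                  -1ℤ ^ toℕ (suc (suc j)) * A zero (suc (suc j)) * det (minor A (suc (suc j))) ≡ 0ℤ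
      rest-zero {suc m} A A₀≗A₁ j = trans
        (cong (-1ℤ ^ toℕ (suc (suc j)) * A zero (suc (suc j)) *_) (det-column₀₁ (minor A (suc (suc j))) (A₀≗A₁ ∘ suc)))
        (*-zeroʳ (-1ℤ ^ toℕ (suc (suc j)) * A zero (suc (suc j))))

    setRow : Fin m → (Fin m → ℤ) → Matrix m → Matrix m
    setRow i v A r with r ≟ i
    ... | yes _ = v
    ... | no  _ = A r

    setRow-eq : ∀ i v (A : Matrix m) l → setRow i v A i l ≡ v l
    setRow-eq i v A l with i ≟ i
    ... | yes _  = refl
    ... | no i≢i = ⊥-elim (i≢i refl)

    setRow-off : ∀ i v (A : Matrix m) → AgreeOff i (setRow i v A) A
    setRow-off i v A r r≢i l with r ≟ i
    ... | yes r≡i = ⊥-elim (r≢i r≡i)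
    ... | no _    = refl

    Alternating : ℕ → Set
    Alternating m = (i j : Fin m) → i ≢ j → (A : Matrix m) → (∀ l → A i l ≡ A j l) → det A ≡ 0ℤ

    -- Polarisation: with u + v placed in both rows the determinant vanishes, and of its four
    -- bilinear terms only the two mixed ones survive. Alternation is a hypothesis because the sign
    -- rule at one size serves to prove alternation at the next.
    det-exchange : Alternating m → ∀ i j → i ≢ j → (A B : Matrix m) →
                (∀ l → A i l ≡ B j l) → (∀ l → A j l ≡ B i l) →
                (∀ r → r ≢ i → r ≢ j → ∀ l → A r l ≡ B r l) → det A ≡ - det B
    det-exchange {m} alt i j i≢j A B Aᵢ≗Bⱼ Aⱼ≗Bᵢ A~B = begin
      det A                                              ≡⟨ det-cong entries-uv ⟩
      det (M u v)                                        ≡⟨ lemma (det (M u v)) (det (M v u)) ⟩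
      (0ℤ + det (M u v)) + (det (M v u) + 0ℤ) - det (M v u)
        ≡⟨ cong₂ (λ x y → (x + det (M u v)) + (det (M v u) + y) - det (M v u)) (diagonal u) (diagonal v) ⟨
      (det (M u u) + det (M u v)) + (det (M v u) + det (M v v)) - det (M v u)
        ≡⟨ cong₂ (λ x y → x + y - det (M v u)) (right u) (right v) ⟨
      det (M u w) + det (M v w) - det (M v u)            ≡⟨ cong (_- det (M v u)) left ⟨
      det (M w w) - det (M v u)                          ≡⟨ cong (_- det (M v u)) (diagonal w) ⟩
      0ℤ - det (M v u)                                   ≡⟨ +-identityˡ _ ⟩
      - det (M v u)                                      ≡⟨ cong -_ (det-cong entries-vu) ⟨
      - det B ∎
      where
      u = A i
      v = A j
      w : Fin m → ℤ
      w l = u l + v l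
      M : (x y : Fin m → ℤ) → Matrix m
      M x y = setRow i x (setRow j y A)
      lemma : ∀ a b → a ≡ (0ℤ + a) + (b + 0ℤ) - b
      lemma = solve-∀
      one : ∀ a b → a + b ≡ 1ℤ * a + 1ℤ * b
      one = solve-∀
      Mᵢ : ∀ x y l → M x y i l ≡ x l
      Mᵢ x y = setRow-eq i x (setRow j y A)
      Mⱼ : ∀ x y l → M x y j l ≡ y l
      Mⱼ x y l = trans (setRow-off i x (setRow j y A) j (i≢j ∘ sym) l) (setRow-eq j y A l)
      Mᵣ : ∀ x y r → r ≢ i → r ≢ j → ∀ l → M x y r l ≡ A r l
      Mᵣ x y r r≢i r≢j l = trans (setRow-off i x (setRow j y A) r r≢i l) (setRow-off j y A r r≢j l)
      diagonal : ∀ x → det (M x x) ≡ 0ℤ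
      diagonal x = alt i j i≢j (M x x) λ l → trans (Mᵢ x x l) (sym (Mⱼ x x l))
      left : det (M w w) ≡ det (M u w) + det (M v w)
      left = trans
        (det-linear i 1ℤ 1ℤ (M w w) (M u w) (M v w)
          (λ l → trans (Mᵢ w w l) (trans (one (u l) (v l)) (cong₂ (λ a b → 1ℤ * a + 1ℤ * b) (sym (Mᵢ u w l)) (sym (Mᵢ v w l)))))
          (λ r r≢i l → trans (setRow-off i w _ r r≢i l) (sym (setRow-off i u _ r r≢i l)))
          (λ r r≢i l → trans (setRow-off i w _ r r≢i l) (sym (setRow-off i v _ r r≢i l))))
        (sym (one (det (M u w)) (det (M v w))))
      offⱼ : ∀ x y z → AgreeOff j (M x y) (M x z)
      offⱼ x y z r r≢j l = helper (r ≟ i)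
        where
        helper : Dec (r ≡ i) → M x y r l ≡ M x z r l
        helper (yes refl) = trans (Mᵢ x y l) (sym (Mᵢ x z l))
        helper (no r≢i)   = trans (Mᵣ x y r r≢i r≢j l) (sym (Mᵣ x z r r≢i r≢j l))
      right : ∀ x → det (M x w) ≡ det (M x u) + det (M x v)
      right x = trans
        (det-linear j 1ℤ 1ℤ (M x w) (M x u) (M x v)
          (λ l → trans (Mⱼ x w l) (trans (one (u l) (v l)) (cong₂ (λ a b → 1ℤ * a + 1ℤ * b) (sym (Mⱼ x u l)) (sym (Mⱼ x v l)))))
          (offⱼ x w u) (offⱼ x w v))
        (sym (one (det (M x u)) (det (M x v))))
      entries-uv : ∀ r l → A r l ≡ M u v r l
      entries-uv r l = helper (r ≟ i) (r ≟ j)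
        where
        helper : Dec (r ≡ i) → Dec (r ≡ j) → A r l ≡ M u v r l
        helper (yes refl) _          = sym (Mᵢ u v l)
        helper (no _)     (yes refl) = sym (Mⱼ u v l)
        helper (no r≢i)   (no r≢j)   = sym (Mᵣ u v r r≢i r≢j l)
      entries-vu : ∀ r l → B r l ≡ M v u r l
      entries-vu r l = helper (r ≟ i) (r ≟ j)
        where
        helper : Dec (r ≡ i) → Dec (r ≡ j) → B r l ≡ M v u r l
        helper (yes refl) _          = trans (sym (Aⱼ≗Bᵢ l)) (sym (Mᵢ v u l))
        helper (no _)     (yes refl) = trans (sym (Aᵢ≗Bⱼ l)) (sym (Mⱼ v u l))
        helper (no r≢i)   (no r≢j)   = trans (sym (A~B r r≢i r≢j l)) (sym (Mᵣ v u r r≢i r≢j l))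

    transpose-first : (i j : Fin m) → transpose i j i ≡ j
    transpose-first i j with i ≟ i
    ... | yes _  = refl
    ... | no i≢i = ⊥-elim (i≢i refl)

    transpose-second : (i j : Fin m) → transpose i j j ≡ i
    transpose-second i j with j ≟ i
    ... | yes j≡i = j≡i
    ... | no _ with j ≟ j
    ...   | yes _  = refl
    ...   | no j≢j = ⊥-elim (j≢j refl)

    transpose-off : (i j r : Fin m) → r ≢ i → r ≢ j → transpose i j r ≡ r
    transpose-off i j r r≢i r≢j with r ≟ i
    ... | yes r≡i = ⊥-elim (r≢i r≡i)
    ... | no _ with r ≟ j
    ...   | yes r≡j = ⊥-elim (r≢j r≡j)
    ...   | no _    = refl

    det-swap : Alternating m → ∀ i j → i ≢ j → (A : Matrix m) → det (λ r → A (transpose i j r)) ≡ - det A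
    det-swap alt i j i≢j A = det-exchange alt i j i≢j (λ r → A (transpose i j r)) A
      (λ l → cong (λ r → A r l) (transpose-first i j))
      (λ l → cong (λ r → A r l) (transpose-second i j))
      (λ r r≢i r≢j l → cong (λ r → A r l) (transpose-off i j r r≢i r≢j))

    det-expand-zero : (A : Matrix (suc m)) → (∀ j → det (minor A j) ≡ 0ℤ) → det A ≡ 0ℤ
    det-expand-zero A minors = sum-zero _ λ j →
      trans (cong (-1ℤ ^ toℕ j * A zero j *_) (minors j)) (*-zeroʳ (-1ℤ ^ toℕ j * A zero j))

    -- Equal rows 0 and 1 become equal columns by transposition. A more distant row is first swapped
    -- into position 1; row 0 stays put, so by the sign rule for the smaller size every minor in the
    -- expansion changes sign.
    row₀-alternating : Alternating m → (j : Fin m) (A : Matrix (suc m)) → (∀ l → A zero l ≡ A (suc j) l) → det A ≡ 0ℤ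

    row₀-alternating {suc m} alt zero    A A₀≗Aⱼ = trans (sym (detᵀ A)) (det-column₀₁ (A ᵀ) A₀≗Aⱼ)
    row₀-alternating {suc m} alt (suc j) A A₀≗Aⱼ = begin
      det A                ≡⟨ lemma (det A) ⟩
      - (-1ℤ * det A + 0ℤ) ≡⟨ cong -_ swapped ⟨
      - det B              ≡⟨ cong -_ (trans (sym (detᵀ B)) (det-column₀₁ (B ᵀ) A₀≗Aⱼ)) ⟩
      0ℤ                   ∎
      where
      lemma : ∀ a → a ≡ - (-1ℤ * a + 0ℤ)
      lemma = solve-∀
      term : ∀ s a d → s * a * - d ≡ -1ℤ * (s * a * d) + 0ℤ * d
      term = solve-∀
      B : Matrix (suc (suc m))
      B zero    = A zero
      B (suc r) = A (suc (transpose zero (suc j) r))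
      swapped : det B ≡ -1ℤ * det A + 0ℤ
      -- The second family has weight 0 and only fills the two-term shape of `sum-linear`.
      swapped = sum-linear -1ℤ 0ℤ _ (λ l → -1ℤ ^ toℕ l * A zero l * det (minor A l)) (λ l → det (minor A l)) λ l → trans
        (cong (-1ℤ ^ toℕ l * A zero l *_)
          (det-swap alt zero (suc j) (λ ()) (minor A l)))
        (term (-1ℤ ^ toℕ l) (A zero l) (det (minor A l)))

    -- If neither of the equal rows is row 0, both survive in every minor of the expansion along row
    -- 0.
    det-alternating : Alternating m
    det-alternating {suc m} zero    zero    i≢j A Aᵢ≗Aⱼ = ⊥-elim (i≢j refl)
    det-alternating {suc m} zero    (suc j) i≢j A Aᵢ≗Aⱼ = row₀-alternating det-alternating j A Aᵢ≗Aⱼ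
    det-alternating {suc m} (suc i) zero    i≢j A Aᵢ≗Aⱼ = row₀-alternating det-alternating i A (sym ∘ Aᵢ≗Aⱼ)
    det-alternating {suc m} (suc i) (suc j) i≢j A Aᵢ≗Aⱼ = det-expand-zero A λ l →
      det-alternating i j (i≢j ∘ cong suc) (minor A l) (Aᵢ≗Aⱼ ∘ punchIn l)

    -- Permuted and scaled rows and columns

    transpose-refl : (i r : Fin m) → transpose i i r ≡ r
    transpose-refl i r with r ≟ i
    ... | yes r≡i = sym r≡i
    ... | no r≢i with r ≟ i
    ...   | yes r≡i = sym r≡i
    ...   | no _    = refl

    -- Only one factor `s` common to all matrices is recorded. Its value is not computed from the
    -- transpositions: for the permutation that matters it is recovered modulo p by testing on a
    -- single nonsingular matrix.
    det-permuteRows : (π : Permutation′ m) → ∃[ s ] (∀ A → det (λ r → A (π ⟨$⟩ʳ r)) ≡ s * det A)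
    det-permuteRows π = let s , permuted = go (decompose π) in
      s , λ A → trans (det-cong λ r l → cong (λ r → A r l) (sym (eval-decompose π r))) (permuted A)
      where
      go : (ts : TranspositionList m) → ∃[ s ] (∀ A → det (λ r → A (eval ts ⟨$⟩ʳ r)) ≡ s * det A)
      go [] = 1ℤ , λ A → sym (*-identityˡ (det A))
      go ((i , j) ∷ ts) with go ts | i ≟ j
      ... | s , permuted | yes refl = s , λ A → trans
            (det-cong λ r l → cong (λ r → A (eval ts ⟨$⟩ʳ r) l) (transpose-refl i r)) (permuted A)
      ... | s , permuted | no i≢j = - s , λ A → begin
        det (λ r → A (eval ts ⟨$⟩ʳ transpose i j r)) ≡⟨ det-swap det-alternating i j i≢j (λ r → A (eval ts ⟨$⟩ʳ r)) ⟩
        - det (λ r → A (eval ts ⟨$⟩ʳ r))             ≡⟨ cong -_ (permuted A) ⟩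
        - (s * det A)                                ≡⟨ lemma s (det A) ⟩
        - s * det A                                  ∎
        where
        lemma : ∀ a b → - (a * b) ≡ - a * b
        lemma = solve-∀

    det-permuteColumns : (π : Permutation′ m) → ∃[ s ] (∀ A → det (λ i j → A i (π ⟨$⟩ʳ j)) ≡ s * det A)
    det-permuteColumns π = let s , permuted = det-permuteRows π in
      s , λ A → begin
        det (λ i j → A i (π ⟨$⟩ʳ j))   ≡⟨ detᵀ (λ i j → A i (π ⟨$⟩ʳ j)) ⟨
        det (λ r → (A ᵀ) (π ⟨$⟩ʳ r))   ≡⟨ permuted (A ᵀ) ⟩
        s * det (A ᵀ)                  ≡⟨ cong (s *_) (detᵀ A) ⟩
        s * det A                      ∎

    -- Rows and columns contribute the same `s`; the factor `s * s` does not affect whether a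
    -- determinant is a square.
    det-permuteBoth : (π : Permutation′ m) →
      ∃[ s ] (∀ A → det (λ i j → A (π ⟨$⟩ʳ i) (π ⟨$⟩ʳ j)) ≡ s * s * det A)
    det-permuteBoth π = let s , permuted = det-permuteRows π in
      s , λ A → begin
        det (λ i j → A (π ⟨$⟩ʳ i) (π ⟨$⟩ʳ j))  ≡⟨ permuted (λ i j → A i (π ⟨$⟩ʳ j)) ⟩
        s * det (λ i j → A i (π ⟨$⟩ʳ j))       ≡⟨ cong (s *_) (detᵀ (λ i j → A i (π ⟨$⟩ʳ j))) ⟨
        s * det (λ r → (A ᵀ) (π ⟨$⟩ʳ r))       ≡⟨ cong (s *_) (permuted (A ᵀ)) ⟩
        s * (s * det (A ᵀ))                    ≡⟨ cong (λ d → s * (s * d)) (detᵀ A) ⟩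
        s * (s * det A)                        ≡⟨ lemma s (det A) ⟩
        s * s * det A                          ∎
      where
      lemma : ∀ a b → a * (a * b) ≡ a * a * b
      lemma = solve-∀

    det-scaleColumns : (w : Fin m → ℤ) (A : Matrix m) → det (λ i j → w j * A i j) ≡ prod w * det A
    det-scaleColumns {zero}  w A = refl
    det-scaleColumns {suc m} w A = begin
      sum (λ j → -1ℤ ^ toℕ j * (w j * A zero j) * det (minor (λ i j → w j * A i j) j)) ≡⟨ sum-cong-≗ step ⟩
      sum (λ j → prod w * (-1ℤ ^ toℕ j * A zero j * det (minor A j)))                  ≡⟨ *-distribˡ-sum (prod w) (λ j → -1ℤ ^ toℕ j * A zero j * det (minor A j)) ⟨
      prod w * det A                                                                  ∎
      where
      lemma : ∀ s a x y d → s * (x * a) * (y * d) ≡ x * y * (s * a * d)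
      lemma = solve-∀
      step : ∀ j → -1ℤ ^ toℕ j * (w j * A zero j) * det (minor (λ i j → w j * A i j) j) ≡
                   prod w * (-1ℤ ^ toℕ j * A zero j * det (minor A j))
      step j = begin
        -1ℤ ^ toℕ j * (w j * A zero j) * det (minor (λ i j → w j * A i j) j)
          ≡⟨ cong (-1ℤ ^ toℕ j * (w j * A zero j) *_) (det-scaleColumns (w ∘ punchIn j) (minor A j)) ⟩
        -1ℤ ^ toℕ j * (w j * A zero j) * (prod (w ∘ punchIn j) * det (minor A j))
          ≡⟨ lemma (-1ℤ ^ toℕ j) (A zero j) (w j) (prod (w ∘ punchIn j)) (det (minor A j)) ⟩
        w j * prod (w ∘ punchIn j) * (-1ℤ ^ toℕ j * A zero j * det (minor A j))
          ≡⟨ cong (_* (-1ℤ ^ toℕ j * A zero j * det (minor A j))) (prod-remove {i = j} w) ⟨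
        prod w * (-1ℤ ^ toℕ j * A zero j * det (minor A j)) ∎

    det-scaleRows : (w : Fin m → ℤ) (A : Matrix m) → det (λ i j → w i * A i j) ≡ prod w * det A
    det-scaleRows w A = begin
      det (λ i j → w i * A i j)        ≡⟨ detᵀ (λ i j → w i * A i j) ⟨
      det (λ i j → w j * (A ᵀ) i j)    ≡⟨ det-scaleColumns w (A ᵀ) ⟩
      prod w * det (A ᵀ)               ≡⟨ cong (prod w *_) (detᵀ A) ⟩
      prod w * det A                   ∎

    -- A row i equal to v is dependent on the rows of N above it.
    Dependent : Matrix m → Fin m → (Fin m → ℤ) → Set
    Dependent N i v =
      ∀ C → (∀ r → toℕ r ℕ.< toℕ i → ∀ l → C r l ≡ N r l) → (∀ l → C i l ≡ v l) → det C ≡ 0ℤ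

    dependent-zero : (N : Matrix m) (i : Fin m) → Dependent N i λ _ → 0ℤ
    -- With both coefficients 0 any matrix can stand for the two summands, so `C` itself does;
    -- `0ℤ * x` computes to `0ℤ`.
    dependent-zero N i C C~N Cᵢ = det-linear i 0ℤ 0ℤ C C C Cᵢ (λ _ _ _ → refl) (λ _ _ _ → refl)

    dependent-row : (N : Matrix m) {i j : Fin m} → toℕ j ℕ.< toℕ i → Dependent N i (N j)
    dependent-row N {i} {j} j<i C C~N Cᵢ =
      det-alternating i j (λ i≡j → ℕ.<⇒≢ j<i (cong toℕ (sym i≡j))) C λ l → trans (Cᵢ l) (sym (C~N j j<i l))

    dependent-linear : (N : Matrix m) {i : Fin m} {u v : Fin m → ℤ} (x y : ℤ) →
      Dependent N i u → Dependent N i v → Dependent N i λ l → x * u l + y * v l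
    dependent-linear N {i} {u} {v} x y u-dep v-dep C C~N Cᵢ = begin
      det C ≡⟨ det-linear i x y C (setRow i u C) (setRow i v C)
                 (λ l → trans (Cᵢ l) (cong₂ (λ a b → x * a + y * b) (sym (setRow-eq i u C l)) (sym (setRow-eq i v C l))))
                 (λ r r≢i l → sym (setRow-off i u C r r≢i l)) (λ r r≢i l → sym (setRow-off i v C r r≢i l)) ⟩
      x * det (setRow i u C) + y * det (setRow i v C)
        ≡⟨ cong₂ (λ a b → x * a + y * b) (u-dep _ (above u) (setRow-eq i u C)) (v-dep _ (above v) (setRow-eq i v C)) ⟩
      x * 0ℤ + y * 0ℤ ≡⟨ cong₂ _+_ (*-zeroʳ x) (*-zeroʳ y) ⟩
      0ℤ ∎
      where
      above : ∀ w r → toℕ r ℕ.< toℕ i → ∀ l → setRow i w C r l ≡ N r l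
      above w r r<i l = trans (setRow-off i w C r (λ r≡i → ℕ.<⇒≢ r<i (cong toℕ r≡i)) l) (C~N r r<i l)

    -- The corrections are removed from the last row upwards. In `go`, rows before `t` are those of
    -- `N` and the others those of `A`; when row `t` is split, the part `E` contributes nothing
    -- because the rows of `N` on which it depends still stand above it.
    det-eliminate : (A N E : Matrix m) → (∀ i l → N i l ≡ A i l + E i l) →
                    (∀ i → Dependent N i (E i)) → det N ≡ det A
    det-eliminate {m} A N E N≗A+E E-dep =
      go m N (λ _ _ _ → refl) λ r m≤r → ⊥-elim (ℕ.<⇒≱ (toℕ<n r) m≤r)
      where
      one : ∀ a b → a + b ≡ 1ℤ * a + 1ℤ * b
      one = solve-∀
      simp : ∀ a → 1ℤ * a + 1ℤ * 0ℤ ≡ a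
      simp = solve-∀
      go : ∀ t (C : Matrix m) → (∀ r → toℕ r ℕ.< t → ∀ l → C r l ≡ N r l) →
           (∀ r → t ℕ.≤ toℕ r → ∀ l → C r l ≡ A r l) → det C ≡ det A
      go zero    C C~N C~A = det-cong λ r → C~A r z≤n
      go (suc t) C C~N C~A with t ℕ.<? m
      -- No row has index `t`, so `C` already satisfies the conditions for `t`.
      ... | no  t≮m = go t C (λ r r<t → C~N r (ℕ.m<n⇒m<1+n r<t)) λ r t≤r → ⊥-elim (t≮m (ℕ.≤-<-trans t≤r (toℕ<n r)))
      ... | yes t<m = begin
        det C ≡⟨ det-linear i 1ℤ 1ℤ C (setRow i (A i) C) (setRow i (E i) C)
                   (λ l → trans (C~N i (s≤s (ℕ.≤-reflexive i≡t)) l) (trans (N≗A+E i l) (trans (one (A i l) (E i l))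
                     (cong₂ (λ a b → 1ℤ * a + 1ℤ * b) (sym (setRow-eq i (A i) C l)) (sym (setRow-eq i (E i) C l))))))
                   (λ r r≢i l → sym (setRow-off i (A i) C r r≢i l)) (λ r r≢i l → sym (setRow-off i (E i) C r r≢i l)) ⟩
        1ℤ * det (setRow i (A i) C) + 1ℤ * det (setRow i (E i) C)
          ≡⟨ cong₂ (λ a b → 1ℤ * a + 1ℤ * b) (go t (setRow i (A i) C) (above (A i)) below)
               (E-dep i (setRow i (E i) C) (λ r r<i → above (E i) r (subst (toℕ r ℕ.<_) i≡t r<i)) (setRow-eq i (E i) C)) ⟩
        1ℤ * det A + 1ℤ * 0ℤ ≡⟨ simp (det A) ⟩
        det A ∎
        where
        i : Fin m
        i = fromℕ< t<m
        i≡t : toℕ i ≡ t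
        i≡t = toℕ-fromℕ< t<m
        above : ∀ w r → toℕ r ℕ.< t → ∀ l → setRow i w C r l ≡ N r l
        above w r r<t l = trans
          (setRow-off i w C r (λ r≡i → ℕ.<⇒≢ r<t (trans (cong toℕ r≡i) i≡t)) l) (C~N r (ℕ.m<n⇒m<1+n r<t) l)
        below : ∀ r → t ℕ.≤ toℕ r → ∀ l → setRow i (A i) C r l ≡ A r l
        below r t≤r l = helper (r ≟ i)
          where
          helper : Dec (r ≡ i) → setRow i (A i) C r l ≡ A r l
          helper (yes refl) = setRow-eq i (A i) C l
          helper (no r≢i)   = trans (setRow-off i (A i) C r r≢i l)
            (C~A r (ℕ.≤∧≢⇒< t≤r λ t≡r → r≢i (toℕ-injective (sym (trans i≡t t≡r)))) l)

    det-row₀-first : (A : Matrix (suc m)) → (∀ j → A zero (suc j) ≡ 0ℤ) → det A ≡ A zero zero * det (minor A zero)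
    det-row₀-first A A₀ⱼ≡0 = trans
      (cong (λ s → 1ℤ * A zero zero * det (minor A zero) + s) (sum-zero _ λ j →
        trans (cong (λ a → -1ℤ ^ toℕ (suc j) * a * det (minor A (suc j))) (A₀ⱼ≡0 j))
              (zero-term (-1ℤ ^ toℕ (suc j)) (det (minor A (suc j))))))
      (lemma (A zero zero) (det (minor A zero)))
      where
      zero-term : ∀ s d → s * 0ℤ * d ≡ 0ℤ
      zero-term = solve-∀
      lemma : ∀ a d → 1ℤ * a * d + 0ℤ ≡ a * d
      lemma = solve-∀

    det-row₀-second : (A : Matrix (suc (suc m))) → A zero zero ≡ 0ℤ → (∀ j → A zero (suc (suc j)) ≡ 0ℤ) →
                      det A ≡ - A zero (suc zero) * det (minor A (suc zero))
    det-row₀-second A A₀₀≡0 A₀ⱼ≡0 = trans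
      (cong₂ (λ a b → 1ℤ * a * det (minor A zero) + (-1ℤ * 1ℤ * A zero (suc zero) * det (minor A (suc zero)) + b))
        A₀₀≡0 (sum-zero _ λ j →
        trans (cong (λ a → -1ℤ ^ toℕ (suc (suc j)) * a * det (minor A (suc (suc j)))) (A₀ⱼ≡0 j))
              (zero-term (-1ℤ ^ toℕ (suc (suc j))) (det (minor A (suc (suc j)))))))
      (lemma (A zero (suc zero)) (det (minor A zero)) (det (minor A (suc zero))))
      where
      zero-term : ∀ s d → s * 0ℤ * d ≡ 0ℤ
      zero-term = solve-∀
      lemma : ∀ a c d → 1ℤ * 0ℤ * c + (-1ℤ * 1ℤ * a * d + 0ℤ) ≡ - a * d
      lemma = solve-∀

    -- Vandermonde determinants

    vandermonde : (Fin m → ℤ) → Matrix m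
    vandermonde x r j = x j ^ toℕ r

    -- Subtracting x₀ times the preceding row from each row clears the first column below its top
    -- entry and leaves a factor xⱼ - x₀ in each other column.
    det-vandermonde : (x : Fin (suc m) → ℤ) →
      det (vandermonde x) ≡ prod (λ j → x (suc j) - x zero) * det (vandermonde (x ∘ suc))
    det-vandermonde {m} x = begin
      det (vandermonde x)        ≡⟨ det-eliminate reduced (vandermonde x) E split E-dependent ⟩
      det reduced                ≡⟨ detᵀ reduced ⟨
      det (reduced ᵀ)            ≡⟨ det-row₀-first (reduced ᵀ) column₀ ⟩
      1ℤ * det (minor (reduced ᵀ) zero) ≡⟨ *-identityˡ _ ⟩
      det (minor (reduced ᵀ) zero)      ≡⟨ det-scaleRows (λ j → x (suc j) - x zero) (vandermonde (x ∘ suc) ᵀ) ⟩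
      prod (λ j → x (suc j) - x zero) * det (vandermonde (x ∘ suc) ᵀ)
        ≡⟨ cong (prod (λ j → x (suc j) - x zero) *_) (detᵀ (vandermonde (x ∘ suc))) ⟩
      prod (λ j → x (suc j) - x zero) * det (vandermonde (x ∘ suc)) ∎
      where
      self : ∀ a b → (a - a) * b ≡ 0ℤ
      self = solve-∀
      reduced E : Matrix (suc m)
      reduced zero    j = 1ℤ
      reduced (suc r) j = (x j - x zero) * x j ^ toℕ r
      column₀ : ∀ j → reduced (suc j) zero ≡ 0ℤ
      column₀ j = self (x zero) (x zero ^ toℕ j)
      E zero    j = 0ℤ
      -- The summand `0ℤ * 0ℤ` gives this row the two-term shape that `dependent-linear` produces.
      E (suc r) j = x zero * vandermonde x (inject₁ r) j + 0ℤ * 0ℤ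
      lemma : ∀ a b y → a * y ≡ (a - b) * y + (b * y + 0ℤ * 0ℤ)
      lemma = solve-∀
      split : ∀ r j → vandermonde x r j ≡ reduced r j + E r j
      split zero    j = refl
      split (suc r) j = trans (lemma (x j) (x zero) (x j ^ toℕ r))
        (cong (λ e → (x j - x zero) * x j ^ toℕ r + (x zero * x j ^ e + 0ℤ * 0ℤ)) (sym (toℕ-inject₁ r)))
      E-dependent : ∀ r → Dependent (vandermonde x) r (E r)
      E-dependent zero    = dependent-zero (vandermonde x) zero
      E-dependent (suc r) = dependent-linear (vandermonde x) (x zero) 0ℤ
        (dependent-row (vandermonde x) (s≤s (ℕ.≤-reflexive (toℕ-inject₁ r)))) (dependent-zero (vandermonde x) (suc r))

    -- Skew-symmetric matrices

    Skew : Matrix m → Set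
    Skew A = ∀ i j → A i j ≡ - A j i

    -- With a the entry at (0, 1) and `A` skew, this is a times the Schur complement of the leading
    -- block with rows (0, a) and (-a, 0); the factor a clears the denominator.
    schur : Matrix (suc (suc m)) → Matrix m
    schur A i j = A zero (suc zero) * A (suc (suc i)) (suc (suc j))
      + (- A (suc (suc i)) (suc zero) * A zero (suc (suc j)) + A (suc (suc i)) zero * A (suc zero) (suc (suc j)))

    schur-skew : {A : Matrix (suc (suc m))} → Skew A → Skew (schur A)
    schur-skew {A = A} skew i j = trans
      (cong₂ _+_ (cong (a *_) (skew (suc (suc i)) (suc (suc j))))
        (cong₂ _+_ (cong₂ (λ u v → - u * v) (skew (suc (suc i)) (suc zero)) (skew zero (suc (suc j))))
                   (cong₂ _*_ (skew (suc (suc i)) zero) (skew (suc zero) (suc (suc j))))))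
      (lemma a (A (suc (suc j)) (suc (suc i))) (A (suc zero) (suc (suc i))) (A (suc (suc j)) zero)
        (A zero (suc (suc i))) (A (suc (suc j)) (suc zero)))
      where
      a = A zero (suc zero)
      lemma : ∀ a b c d e f → a * - b + (- (- c) * - d + - e * - f) ≡ - (a * b + (- f * e + d * c))
      lemma = solve-∀

    skew-diagonal : {A : Matrix m} → Skew A → ∀ i → A i i ≡ 0ℤ
    skew-diagonal {A = A} skew i = self-neg (A i i) (skew i i)
      where
      self-neg : ∀ a → a ≡ - a → a ≡ 0ℤ
      -- For a nonzero integer the two sides have different constructors.
      self-neg (+ zero) _ = refl

    -- All rows but the first two are multiplied by the pivot a, which accounts for aᵐ. Combinations
    -- of the first two rows then clear the first two columns below the leading block, whose
    -- determinant is a².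
    skew-det : (A : Matrix (suc (suc m))) → Skew A →
      prod {m} (λ _ → A zero (suc zero)) * det A ≡ A zero (suc zero) * A zero (suc zero) * det (schur A)
    skew-det {m} A skew = begin
      prod {m} (λ _ → a) * det A                ≡⟨ cong (_* det A) (trans (*-identityˡ _) (*-identityˡ (prod {m} λ _ → a))) ⟨
      prod w * det A                            ≡⟨ det-scaleRows w A ⟨
      det (λ i j → w i * A i j)                 ≡⟨ det-eliminate (λ i j → w i * A i j) N E split E-dependent ⟨
      det N                                     ≡⟨ detᵀ N ⟨
      -- Row 0 of `N ᵀ` is column 0 of `N`, where only the entry -a in row 1 remains.
      det (N ᵀ)                                 ≡⟨ det-row₀-second (N ᵀ) (skew-diagonal skew zero) (λ _ → refl) ⟩
      - A (suc zero) zero * det (minor (N ᵀ) (suc zero))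
        ≡⟨ cong₂ _*_ (sym (skew zero (suc zero))) (det-row₀-first (minor (N ᵀ) (suc zero)) (λ _ → refl)) ⟩
      a * (a * det (schur A ᵀ))                 ≡⟨ cong (λ d → a * (a * d)) (detᵀ (schur A)) ⟩
      a * (a * det (schur A))                   ≡⟨ assoc a (det (schur A)) ⟩
      a * a * det (schur A)                     ∎
      where
      a = A zero (suc zero)
      assoc : ∀ a b → a * (a * b) ≡ a * a * b
      assoc = solve-∀
      w : Fin (suc (suc m)) → ℤ
      w zero          = 1ℤ
      w (suc zero)    = 1ℤ
      w (suc (suc i)) = a
      N E : Matrix (suc (suc m))
      N zero          j             = A zero j
      N (suc zero)    j             = A (suc zero) j
      N (suc (suc i)) zero          = 0ℤ
      N (suc (suc i)) (suc zero)    = 0ℤ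
      N (suc (suc i)) (suc (suc j)) = schur A i j
      E zero          j = 0ℤ
      E (suc zero)    j = 0ℤ
      E (suc (suc i)) j = - A (suc (suc i)) (suc zero) * N zero j + A (suc (suc i)) zero * N (suc zero) j
      row : ∀ a → a ≡ 1ℤ * a + 0ℤ
      row = solve-∀
      column₀ : ∀ a x y → 0ℤ ≡ a * x + (- y * 0ℤ + x * - a)
      column₀ = solve-∀
      column₁ : ∀ a x y → 0ℤ ≡ a * y + (- y * a + x * 0ℤ)
      column₁ = solve-∀
      split : ∀ i j → N i j ≡ w i * A i j + E i j
      split zero          j          = row (A zero j)
      split (suc zero)    j          = row (A (suc zero) j)
      split (suc (suc i)) zero       = trans (column₀ a (A (suc (suc i)) zero) (A (suc (suc i)) (suc zero)))
        (cong₂ (λ u v → a * A (suc (suc i)) zero + (- A (suc (suc i)) (suc zero) * u + A (suc (suc i)) zero * v))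
          (sym (skew-diagonal skew zero)) (sym (skew (suc zero) zero)))
      split (suc (suc i)) (suc zero) = trans (column₁ a (A (suc (suc i)) zero) (A (suc (suc i)) (suc zero)))
        (cong (λ v → a * A (suc (suc i)) (suc zero) + (- A (suc (suc i)) (suc zero) * a + A (suc (suc i)) zero * v))
          (sym (skew-diagonal skew (suc zero))))
      split (suc (suc i)) (suc (suc j)) = refl
      E-dependent : ∀ i → Dependent N i (E i)
      E-dependent zero          = dependent-zero N zero
      E-dependent (suc zero)    = dependent-zero N (suc zero)
      E-dependent (suc (suc i)) = dependent-linear N (- A (suc (suc i)) (suc zero)) (A (suc (suc i)) zero)
        (dependent-row N (s≤s z≤n)) (dependent-row N (s≤s (s≤s z≤n)))

  -- Congruences

  ^-distrib-* : ∀ a b n → (a * b) ^ n ≡ a ^ n * b ^ n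
  ^-distrib-* a b zero    = refl
  ^-distrib-* a b (suc n) = trans (cong (a * b *_) (^-distrib-* a b n)) (lemma a b (a ^ n) (b ^ n))
    where
    lemma : ∀ a b x y → a * b * (x * y) ≡ a * x * (b * y)
    lemma = solve-∀

  module Congruence (p : ℕ) where

    infix 4 _≋_

    -- The record makes both sides of a congruence inferable.
    record _≋_ (a b : ℤ) : Set where
      constructor mod
      field modulus∣ : a ≡ b [mod p ]
    open _≋_ public

    reflexive : ∀ {a b} → a ≡ b → a ≋ b
    reflexive {a} refl = mod (divides 0ℤ (self a))
      where
      self : ∀ a → a - a ≡ 0ℤ
      self = solve-∀

    ≋-refl : ∀ {a} → a ≋ a
    ≋-refl = reflexive refl

    ≋-sym : ∀ {a b} → a ≋ b → b ≋ a
    ≋-sym {a} {b} (mod p∣) = mod (subst (+ p ∣_) (lemma a b) (∣m⇒∣-m p∣))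
      where
      lemma : ∀ a b → - (a - b) ≡ b - a
      lemma = solve-∀

    ≋-trans : ∀ {a b c} → a ≋ b → b ≋ c → a ≋ c
    ≋-trans {a} {b} {c} (mod p∣₁) (mod p∣₂) = mod (subst (+ p ∣_) (lemma a b c) (∣m∣n⇒∣m+n p∣₁ p∣₂))
      where
      lemma : ∀ a b c → (a - b) + (b - c) ≡ a - c
      lemma = solve-∀

    ≋-setoid : Setoid _ _
    ≋-setoid = record
      { _≈_ = _≋_
      ; isEquivalence = record { refl = ≋-refl ; sym = ≋-sym ; trans = ≋-trans }
      }

    module ≋-Reasoning = SetoidReasoning ≋-setoid

    +-cong : ∀ {a b c d} → a ≋ b → c ≋ d → a + c ≋ b + d
    +-cong {a} {b} {c} {d} (mod p∣₁) (mod p∣₂) = mod (subst (+ p ∣_) (lemma a b c d) (∣m∣n⇒∣m+n p∣₁ p∣₂))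
      where
      lemma : ∀ a b c d → (a - b) + (c - d) ≡ (a + c) - (b + d)
      lemma = solve-∀

    neg-cong : ∀ {a b} → a ≋ b → - a ≋ - b
    neg-cong {a} {b} (mod p∣) = mod (subst (+ p ∣_) (lemma a b) (∣m⇒∣-m p∣))
      where
      lemma : ∀ a b → - (a - b) ≡ - a - - b
      lemma = solve-∀

    *-cong : ∀ {a b c d} → a ≋ b → c ≋ d → a * c ≋ b * d
    *-cong {a} {b} {c} {d} (mod p∣₁) (mod p∣₂) =
      mod (subst (+ p ∣_) (lemma a b c d) (∣m∣n⇒∣m+n (∣m⇒∣m*n c p∣₁) (∣n⇒∣m*n b p∣₂)))
      where
      lemma : ∀ a b c d → (a - b) * c + b * (c - d) ≡ a * c - b * d
      lemma = solve-∀

    *-congˡ : ∀ a {c d} → c ≋ d → a * c ≋ a * d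
    *-congˡ a = *-cong (≋-refl {a})

    *-congʳ : ∀ c {a b} → a ≋ b → a * c ≋ b * c
    *-congʳ c a≋b = *-cong a≋b (≋-refl {c})

    ^-cong : ∀ {a b} n → a ≋ b → a ^ n ≋ b ^ n
    ^-cong zero    a≋b = ≋-refl
    ^-cong (suc n) a≋b = *-cong a≋b (^-cong n a≋b)

    sum-cong : ∀ {m} {f g : Fin m → ℤ} → (∀ i → f i ≋ g i) → sum f ≋ sum g
    sum-cong {zero}  f≋g = ≋-refl
    sum-cong {suc m} f≋g = +-cong (f≋g zero) (sum-cong (f≋g ∘ suc))

    prod-cong-≋ : ∀ {m} {f g : Fin m → ℤ} → (∀ i → f i ≋ g i) → prod f ≋ prod g
    prod-cong-≋ {zero}  f≋g = ≋-refl
    prod-cong-≋ {suc m} f≋g = *-cong (f≋g zero) (prod-cong-≋ (f≋g ∘ suc))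

    det-cong-≋ : ∀ {m} {A B : Matrix m} → (∀ i j → A i j ≋ B i j) → det A ≋ det B
    det-cong-≋ {zero}  A≋B = ≋-refl
    det-cong-≋ {suc m} A≋B = sum-cong λ j →
      *-cong (*-congˡ (-1ℤ ^ toℕ j) (A≋B zero j)) (det-cong-≋ λ i l → A≋B (suc i) (punchIn j l))

    ∣⇒≋0 : ∀ {a} → + p ∣ a → a ≋ 0ℤ
    ∣⇒≋0 {a} p∣a = mod (subst (+ p ∣_) (sym (+-identityʳ a)) p∣a)

    ≋0⇒∣ : ∀ {a} → a ≋ 0ℤ → + p ∣ a
    ≋0⇒∣ {a} (mod p∣) = subst (+ p ∣_) (+-identityʳ a) p∣

    -- Overwriting one row by the other preserves the determinant modulo p and turns congruent rows
    -- into equal ones.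
    det-alternating-≋ : ∀ {m} (A : Matrix m) i j → i ≢ j → (∀ l → A i l ≋ A j l) → + p ∣ det A
    det-alternating-≋ A i j i≢j Aᵢ≋Aⱼ = ≋0⇒∣ (≋-trans (det-cong-≋ entries)
      (reflexive (det-alternating i j i≢j B λ l →
        trans (setRow-off j (A i) A i i≢j l) (sym (setRow-eq j (A i) A l)))))
      where
      B = setRow j (A i) A
      entries : ∀ r l → A r l ≋ B r l
      entries r l = helper (r ≟ j)
        where
        helper : Dec (r ≡ j) → A r l ≋ B r l
        helper (yes refl) = ≋-trans (≋-sym (Aᵢ≋Aⱼ l)) (reflexive (sym (setRow-eq j (A i) A l)))
        helper (no r≢j)   = reflexive (sym (setRow-off j (A i) A r r≢j l))

    ∣-resp-≋ : ∀ {a b} → a ≋ b → + p ∣ a → + p ∣ b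
    ∣-resp-≋ a≋b p∣a = ≋0⇒∣ (≋-trans (≋-sym a≋b) (∣⇒≋0 p∣a))

    %ℕ-≋ : ∀ a .{{_ : ℕ.NonZero p}} → a ≋ + (a %ℕ p)
    %ℕ-≋ a = mod (divides (a /ℕ p) (trans (cong (_- + (a %ℕ p)) (a≡a%ℕn+[a/ℕn]*n a p)) (lemma (+ (a %ℕ p)) (a /ℕ p * + p))))
      where
      lemma : ∀ r q → r + q - r ≡ q
      lemma = solve-∀

  -- Congruences modulo a prime

  module PrimeCongruence {p : ℕ} (p-prime : Prime p) where

    open Congruence p public

    private instance
      p-nonZero : ℕ.NonZero p
      p-nonZero = prime⇒nonZero p-prime

    euclid : ∀ a b → + p ∣ a * b → + p ∣ a ⊎ + p ∣ b
    euclid a b p∣ab with euclidsLemma (abs a) (abs b) p-prime (subst (p ℕ∣.∣_) (abs-* a b) (∣⇒∣ᵤ p∣ab))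
    ... | inj₁ p∣a = inj₁ (∣ᵤ⇒∣ p∣a)
    ... | inj₂ p∣b = inj₂ (∣ᵤ⇒∣ p∣b)

    ∤-* : ∀ {a b} → ¬ + p ∣ a → ¬ + p ∣ b → ¬ + p ∣ a * b
    ∤-* {a} {b} p∤a p∤b p∣ab = [ p∤a , p∤b ]′ (euclid a b p∣ab)

    ∤1 : ¬ + p ∣ 1ℤ
    ∤1 p∣1 = ℕ.nonTrivial⇒≢1 {{prime⇒nonTrivial p-prime}} (ℕ∣.∣1⇒≡1 (∣⇒∣ᵤ p∣1))

    ∤-prod : ∀ {m} (f : Fin m → ℤ) → (∀ i → ¬ + p ∣ f i) → ¬ + p ∣ prod f
    ∤-prod {zero}  f p∤f = ∤1
    ∤-prod {suc m} f p∤f = ∤-* (p∤f zero) (∤-prod (f ∘ suc) (p∤f ∘ suc))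

    ∤-^ : ∀ {a} n → ¬ + p ∣ a → ¬ + p ∣ a ^ n
    ∤-^ zero    p∤a = ∤1
    ∤-^ (suc n) p∤a = ∤-* p∤a (∤-^ n p∤a)

    *-cancelˡ : ∀ {c a b} → ¬ + p ∣ c → c * a ≋ c * b → a ≋ b
    *-cancelˡ {c} {a} {b} p∤c (mod p∣) with euclid c (a - b) (subst (+ p ∣_) (lemma c a b) p∣)
      where
      lemma : ∀ c a b → c * a - c * b ≡ c * (a - b)
      lemma = solve-∀
    ... | inj₁ p∣c   = ⊥-elim (p∤c p∣c)
    ... | inj₂ p∣a-b = mod p∣a-b

    *-cancelʳ : ∀ {c a b} → ¬ + p ∣ c → a * c ≋ b * c → a ≋ b
    *-cancelʳ {c} {a} {b} p∤c ac≋bc =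
      *-cancelˡ p∤c (≋-trans (reflexive (*-comm c a)) (≋-trans ac≋bc (reflexive (*-comm b c))))

    -- The gcd of the remainder of a with p divides p, so it is 1 or p. The value p would give p ∣
    -- a; otherwise the Bézout coefficient is the inverse, negated when the identity comes with the
    -- opposite sign.
    inverse : ∀ {a} → ¬ + p ∣ a → ∃[ b ] (a * b ≋ 1ℤ)
    inverse {a} p∤a with Bézout.lemma (a %ℕ p) p
    ... | Bézout.result d (GCD.is (d∣a , d∣p) _) identity with prime⇒irreducible p-prime d∣p
    ...   | inj₂ refl = ⊥-elim (p∤a (∣-resp-≋ (≋-sym (%ℕ-≋ a)) (∣ᵤ⇒∣ d∣a)))
    ...   | inj₁ refl = helper identity
      where
      r = a %ℕ p
      lemma₁ : ∀ r x y p → 1ℤ + y * p ≡ x * r → r * x - 1ℤ ≡ y * p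
      lemma₁ r x y p eq = trans (cong (_- 1ℤ) (trans (*-comm r x) (sym eq))) (simp (y * p))
        where
        simp : ∀ z → 1ℤ + z - 1ℤ ≡ z
        simp = solve-∀
      lemma₂ : ∀ r x y p → 1ℤ + x * r ≡ y * p → r * - x - 1ℤ ≡ - y * p
      lemma₂ r x y p eq = trans (simp r x) (trans (cong -_ eq) (simp′ y p))
        where
        simp : ∀ r x → r * - x - 1ℤ ≡ - (1ℤ + x * r)
        simp = solve-∀
        simp′ : ∀ y p → - (y * p) ≡ - y * p
        simp′ = solve-∀
      cast : ∀ u v w z → 1 ℕ.+ u ℕ.* v ≡ w ℕ.* z → 1ℤ + + u * + v ≡ + w * + z
      cast u v w z eq = trans (cong (λ z → 1ℤ + z) (sym (pos-* u v))) (trans (cong (λ n → + n) eq) (pos-* w z))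
      helper : Bézout.Identity 1 r p → ∃[ b ] (a * b ≋ 1ℤ)
      helper (Bézout.+- x y eq) = + x ,
        ≋-trans (*-congʳ _ (%ℕ-≋ a)) (mod (divides (+ y) (lemma₁ (+ r) (+ x) (+ y) (+ p) (cast y p x r eq))))
      helper (Bézout.-+ x y eq) = - + x ,
        ≋-trans (*-congʳ _ (%ℕ-≋ a)) (mod (divides (- + y) (lemma₂ (+ r) (+ x) (+ y) (+ p) (cast x r y p eq))))

    square-root-of-1 : ∀ {a} → a * a ≋ 1ℤ → a ≋ 1ℤ ⊎ a ≋ -1ℤ
    square-root-of-1 {a} (mod p∣) with euclid (a - 1ℤ) (a - -1ℤ) (subst (+ p ∣_) (lemma a) p∣)
      where
      lemma : ∀ a → a * a - 1ℤ ≡ (a - 1ℤ) * (a - -1ℤ)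
      lemma = solve-∀
    ... | inj₁ p∣a-1 = inj₁ (mod p∣a-1)
    ... | inj₂ p∣a+1 = inj₂ (mod p∣a+1)

    Injective : ∀ {m} → (Fin m → ℤ) → Set
    Injective x = ∀ i j → x i ≋ x j → i ≡ j

    -- The determinant is a product of differences of points, none of which is divisible by p.
    vandermonde-nonsingular : ∀ {m} (x : Fin m → ℤ) → Injective x → ¬ + p ∣ det (vandermonde x)
    vandermonde-nonsingular {zero}  x inj = ∤1
    vandermonde-nonsingular {suc m} x inj = subst (λ d → ¬ + p ∣ d) (sym (det-vandermonde x))
      (∤-* (∤-prod _ λ j p∣ → 0≢1+n (sym (inj (suc j) zero (mod p∣))))
           (vandermonde-nonsingular (x ∘ suc) λ i j eq → suc-injective (inj (suc i) (suc j) eq)))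

    -- Zero counts as a square, so a determinant divisible by p needs no separate treatment until
    -- Legendre symbols are compared.
    IsSquare : ℤ → Set
    IsSquare a = ∃[ y ] (a ≋ y * y)

    square-resp : ∀ {a b} → a ≋ b → IsSquare a → IsSquare b
    square-resp a≋b (y , a≋yy) = y , ≋-trans (≋-sym a≋b) a≋yy

    square-* : ∀ {a b} → IsSquare a → IsSquare b → IsSquare (a * b)
    square-* (y , a≋) (z , b≋) = y * z , ≋-trans (*-cong a≋ b≋) (reflexive (lemma y z))
      where
      lemma : ∀ y z → y * y * (z * z) ≡ y * z * (y * z)
      lemma = solve-∀

    square-cancel : ∀ {c a} → ¬ + p ∣ c → IsSquare (c * c * a) → IsSquare a
    square-cancel {c} {a} p∤c (y , cca≋) with inverse p∤c
    ... | b , cb≋1 = b * y , (begin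
      a                         ≡⟨ lemma₁ a ⟩
      1ℤ * 1ℤ * a               ≈⟨ *-congʳ a (*-cong cb≋1 cb≋1) ⟨
      c * b * (c * b) * a       ≡⟨ lemma₂ a b c ⟩
      b * b * (c * c * a)       ≈⟨ *-congˡ (b * b) cca≋ ⟩
      b * b * (y * y)           ≡⟨ lemma₃ b y ⟩
      b * y * (b * y)           ∎)
      where
      open ≋-Reasoning
      lemma₁ : ∀ a → a ≡ 1ℤ * 1ℤ * a
      lemma₁ = solve-∀
      lemma₂ : ∀ a b c → c * b * (c * b) * a ≡ b * b * (c * c * a)
      lemma₂ = solve-∀
      lemma₃ : ∀ b y → b * b * (y * y) ≡ b * y * (b * y)
      lemma₃ = solve-∀

    -- Skew-symmetric determinants modulo p

    const-prod-square : ∀ h a → prod {h ℕ.* 2} (λ _ → a) ≡ a ^ h * a ^ h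
    const-prod-square zero    a = refl
    const-prod-square (suc h) a = trans (cong (λ z → a * (a * z)) (const-prod-square h a)) (lemma a (a ^ h))
      where
      lemma : ∀ a b → a * (a * (b * b)) ≡ a * b * (a * b)
      lemma = solve-∀

    -- If row 0 vanishes modulo p, so does the determinant. Otherwise an entry prime to p is moved
    -- to position (0, 1) by the same transposition of rows and columns, which preserves skewness
    -- and changes the determinant by a square factor.
    skew-det-square : ∀ h (A : Matrix (h ℕ.* 2)) → Skew A → IsSquare (det A)
    -- From a^(2h) · det A = a² · det (schur A): the right side is a square by induction, and the
    -- square factor a^(2h) is prime to p and cancels.
    skew-det-square-pivot : ∀ h (A : Matrix (suc h ℕ.* 2)) → Skew A → ¬ + p ∣ A zero (suc zero) → IsSquare (det A)

    skew-det-square zero    A skew = 1ℤ , ≋-refl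
    skew-det-square (suc h) A skew with any? (λ j → ¬? (+ p ∣? A zero j))
    ... | yes (zero  , p∤a) = ⊥-elim (p∤a (subst (+ p ∣_) (sym (skew-diagonal skew zero)) (divides 0ℤ refl)))
    ... | yes (suc j , p∤a) = square-resp (reflexive (trans (sym (permuted A′)) A″≡A))
            (square-* (s , ≋-refl)
              (skew-det-square-pivot h A′ (λ u v → skew (τ u) (τ v)) p∤a))
      where
      π = transposition (suc zero) (suc j)
      τ = π ⟨$⟩ʳ_
      A′ : Matrix (suc h ℕ.* 2)
      A′ u v = A (τ u) (τ v)
      -- The same transposition with its arguments reversed, the form in which `transpose-inverse`
      -- undoes `τ`.
      s = proj₁ (det-permuteBoth (transposition (suc j) (suc zero)))
      permuted = proj₂ (det-permuteBoth (transposition (suc j) (suc zero)))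
      A″≡A : det (λ u v → A′ (transpose (suc j) (suc zero) u) (transpose (suc j) (suc zero) v)) ≡ det A
      A″≡A = det-cong {B = A} λ u v → cong₂ A (transpose-inverse (suc zero) (suc j)) (transpose-inverse (suc zero) (suc j))
    ... | no ¬p∤ = 0ℤ , ≋-trans (sum-cong λ j →
            ≋-trans (*-congʳ (det (minor A j)) (*-congˡ (-1ℤ ^ toℕ j) (row₀≋0 j)))
                    (reflexive (lemma (-1ℤ ^ toℕ j) (det (minor A j)))))
            (reflexive (sum-replicate-zero (suc h ℕ.* 2)))
      where
      row₀≋0 : ∀ j → A zero j ≋ 0ℤ
      row₀≋0 j with + p ∣? A zero j
      ... | yes p∣a = ∣⇒≋0 p∣a
      ... | no p∤a  = ⊥-elim (¬p∤ (j , p∤a))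
      lemma : ∀ s d → s * 0ℤ * d ≡ 0ℤ
      lemma = solve-∀

    skew-det-square-pivot h A skew p∤a = square-cancel {a ^ h} (∤-^ h p∤a)
      (square-resp (reflexive (trans (sym (skew-det A skew)) (cong (_* det A) (const-prod-square h a))))
        (square-* (a , ≋-refl) (skew-det-square h (schur A) (schur-skew skew))))
      where
      a = A zero (suc zero)

  -- The group of k-th power residues

  even⊎odd : ∀ n → (∃[ q ] n ≡ q ℕ.* 2) ⊎ (∃[ q ] n ≡ suc (q ℕ.* 2))
  even⊎odd zero    = inj₁ (0 , refl)
  even⊎odd (suc n) with even⊎odd n
  ... | inj₁ (q , refl) = inj₂ (q , refl)
  ... | inj₂ (q , refl) = inj₁ (suc q , refl)

  odd-half : ∀ {n} → 2 ℕ∣.∤ n → ∃[ q ] n ≡ suc (q ℕ.* 2)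
  odd-half {n} 2∤n with even⊎odd n
  ... | inj₁ (q , n≡) = ⊥-elim (2∤n (ℕ∣.divides q n≡))
  ... | inj₂ odd      = odd

  ^-double : ∀ a q → a ^ (q ℕ.* 2) ≡ a ^ q * a ^ q
  ^-double a q = trans (sym (^-*-assoc a q 2)) (cong (a ^ q *_) (*-identityʳ (a ^ q)))

  neg-^-odd : ∀ a q → (- a) ^ suc (q ℕ.* 2) ≡ - (a ^ suc (q ℕ.* 2))
  neg-^-odd a q = begin
    - a * (- a) ^ (q ℕ.* 2)      ≡⟨ cong (- a *_) (^-double (- a) q) ⟩
    - a * ((- a) ^ q * (- a) ^ q) ≡⟨ cong (- a *_) (^-distrib-* (- a) (- a) q) ⟨
    - a * (- a * - a) ^ q        ≡⟨ cong (λ z → - a * z ^ q) (neg-neg a) ⟩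
    - a * (a * a) ^ q            ≡⟨ cong (- a *_) (^-distrib-* a a q) ⟩
    - a * (a ^ q * a ^ q)        ≡⟨ cong (- a *_) (^-double a q) ⟨
    - a * a ^ (q ℕ.* 2)          ≡⟨ lemma a (a ^ (q ℕ.* 2)) ⟩
    - (a * a ^ (q ℕ.* 2))        ∎
    where
    open ≡-Reasoning
    neg-neg : ∀ a → - a * - a ≡ a * a
    neg-neg = solve-∀
    lemma : ∀ a b → - a * b ≡ - (a * b)
    lemma = solve-∀

  prod-scale : ∀ {m} c (f : Fin m → ℤ) → prod (λ j → c * f j) ≡ c ^ m * prod f
  prod-scale {zero}  c f = refl
  prod-scale {suc m} c f = trans (cong (c * f zero *_) (prod-scale c (f ∘ suc))) (lemma c (f zero) (c ^ m) (prod (f ∘ suc)))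
    where
    lemma : ∀ c a x y → c * a * (x * y) ≡ c * x * (a * y)
    lemma = solve-∀

  -- This is c^(m(m-1)/2), kept as a product to avoid halving the exponent.
  powers : ℤ → ℕ → ℤ
  powers c m = prod {m} λ r → c ^ toℕ r

  powers-suc : ∀ c m → powers c (suc m) ≡ c ^ m * powers c m
  powers-suc c m = trans (*-identityˡ (prod {m} λ r → c * c ^ toℕ r)) (prod-scale {m} c (λ r → c ^ toℕ r))

  -- The exponents 0, …, 2h − 1 add up to 2h² − h.
  powers-double : ∀ c h → powers c (h ℕ.* 2) * c ^ h ≡ c ^ (h ℕ.* h) * c ^ (h ℕ.* h)
  powers-double c zero    = refl
  powers-double c (suc h) = begin
    powers c (2 ℕ.+ h ℕ.* 2) * (c * C)          ≡⟨ cong (_* (c * C)) step ⟩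
    c * (C * C) * (C * C * P) * (c * C)         ≡⟨ lemma₁ c C P ⟩
    (c * (C * C)) * (c * (C * C)) * (P * C)     ≡⟨ cong ((c * (C * C)) * (c * (C * C)) *_) (powers-double c h) ⟩
    (c * (C * C)) * (c * (C * C)) * (Q * Q)     ≡⟨ lemma₂ c C Q ⟩
    c * (C * (C * Q)) * (c * (C * (C * Q)))     ≡⟨ cong (λ z → z * z) exponent ⟨
    c ^ (suc h ℕ.* suc h) * c ^ (suc h ℕ.* suc h) ∎
    where
    open ≡-Reasoning
    C = c ^ h
    P = powers c (h ℕ.* 2)
    Q = c ^ (h ℕ.* h)
    lemma₁ : ∀ c C P → c * (C * C) * (C * C * P) * (c * C) ≡ (c * (C * C)) * (c * (C * C)) * (P * C)
    lemma₁ = solve-∀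
    lemma₂ : ∀ c C Q → (c * (C * C)) * (c * (C * C)) * (Q * Q) ≡ c * (C * (C * Q)) * (c * (C * (C * Q)))
    lemma₂ = solve-∀
    exponent : c ^ (suc h ℕ.* suc h) ≡ c * (C * (C * Q))
    exponent = cong (c *_) (trans (^-distribˡ-+-* c h (h ℕ.* suc h)) (cong (C *_)
      (trans (cong (c ^_) (ℕ.*-suc h h)) (^-distribˡ-+-* c h (h ℕ.* h)))))
    step : powers c (2 ℕ.+ h ℕ.* 2) ≡ c * (C * C) * (C * C * P)
    step = trans (powers-suc c (suc (h ℕ.* 2)))
      (cong₂ (λ x y → c * x * y) (^-double c h) (trans (powers-suc c (h ℕ.* 2)) (cong (_* P) (^-double c h))))

  residues-equal : ∀ {k i j} → i ℕ.< k → j ℕ.< k → + k ∣ + i - + j → i ≡ j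
  residues-equal {k} {i} {j} i<k j<k k∣i-j = +-injective (i-j≡0⇒i≡j (+ i) (+ j) (∣i∣≡0⇒i≡0 small))
    where
    bound : abs (+ i - + j) ℕ.< k
    bound = ℕ.≤-<-trans (subst (λ z → abs z ℕ.≤ i ℕ.⊔ j) (sym (m-n≡m⊖n i j)) (∣m⊝n∣≤m⊔n i j)) (ℕ.⊔-pres-<m i<k j<k)
    small : abs (+ i - + j) ≡ 0
    small with abs (+ i - + j) | bound | ∣⇒∣ᵤ k∣i-j
    ... | zero  | _  | _  = refl
    ... | suc n | lt | dv = ⊥-elim (ℕ∣.>⇒∤ lt dv)

  module PowerResidues
    {p : ℕ} (p-prime : Prime p) (k m : ℕ) .{{_ : ℕ.NonZero k}} (m*k≡p-1 : m ℕ.* k ≡ p ∸ 1)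
    (α : Fin m → ℤ) (residue : ∀ i → IsNonzeroPowerResidue k p (α i))
    (distinct : ∀ i j → α i ≡ α j [mod p ] → i ≡ j)
    (complete : ∀ a → IsNonzeroPowerResidue k p a → ∃[ i ] (α i ≡ a [mod p ]))
    where

    open PrimeCongruence p-prime

    private instance
      p-nonZero : ℕ.NonZero p
      p-nonZero = prime⇒nonZero p-prime

    record Residue (a : ℤ) : Set where
      constructor residue-by
      field
        non-multiple : ¬ + p ∣ a
        root         : ℤ
        root^k       : root ^ k ≋ a
    open Residue public

    to-residue : ∀ {a} → IsNonzeroPowerResidue k p a → Residue a
    to-residue (p∤a , x , xᵏ≡a) = residue-by p∤a x (mod xᵏ≡a)

    from-residue : ∀ {a} → Residue a → IsNonzeroPowerResidue k p a
    from-residue r = non-multiple r , root r , modulus∣ (root^k r)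

    injective : Injective α
    injective i j eq = distinct i j (modulus∣ eq)

    α-residue : ∀ i → Residue (α i)
    α-residue i = to-residue (residue i)

    index : ∀ {a} → Residue a → Fin m
    index {a} r = proj₁ (complete a (from-residue r))

    α-index : ∀ {a} (r : Residue a) → α (index r) ≋ a
    α-index {a} r = mod (proj₂ (complete a (from-residue r)))

    residue-resp : ∀ {a b} → a ≋ b → Residue a → Residue b
    residue-resp a≋b (residue-by p∤a x xᵏ≋a) =
      residue-by (λ p∣b → p∤a (∣-resp-≋ (≋-sym a≋b) p∣b)) x (≋-trans xᵏ≋a a≋b)

    residue-1 : Residue 1ℤ
    residue-1 = residue-by ∤1 1ℤ (reflexive (^-zeroˡ k))

    residue-* : ∀ {a b} → Residue a → Residue b → Residue (a * b)
    residue-* {a} {b} (residue-by p∤a x xᵏ≋a) (residue-by p∤b y yᵏ≋b) =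
      residue-by (∤-* {a} {b} p∤a p∤b) (x * y) (≋-trans (reflexive (^-distrib-* x y k)) (*-cong xᵏ≋a yᵏ≋b))

    residue-^ : ∀ {a} n → Residue a → Residue (a ^ n)
    residue-^ zero    _  = residue-1
    residue-^ (suc n) ra = residue-* ra (residue-^ n ra)

    ∣-^ : ∀ {x} n .{{_ : ℕ.NonZero n}} → + p ∣ x → + p ∣ x ^ n
    ∣-^ {x} (suc n) p∣x = ∣m⇒∣m*n (x ^ n) p∣x

    root-non-multiple : ∀ {a} (r : Residue a) → ¬ + p ∣ root r
    root-non-multiple r p∣x = non-multiple r (∣-resp-≋ (root^k r) (∣-^ k p∣x))

    ∤-unitʳ : ∀ {a b} → a * b ≋ 1ℤ → ¬ + p ∣ b
    ∤-unitʳ {a} {b} ab≋1 p∣b = ∤1 (∣-resp-≋ ab≋1 (∣n⇒∣m*n a p∣b))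

    residue-inverse : ∀ {c} → Residue c → ∃[ b ] (Residue b × c * b ≋ 1ℤ)
    residue-inverse {c} r with inverse {root r} (root-non-multiple r)
    ... | y , xy≋1 = y ^ k , residue-by (∤-unitʳ {c} {y ^ k} unit) y ≋-refl , unit
      where
      open ≋-Reasoning
      unit : c * y ^ k ≋ 1ℤ
      unit = begin
        c * y ^ k            ≈⟨ *-congʳ (y ^ k) (root^k r) ⟨
        root r ^ k * y ^ k   ≡⟨ ^-distrib-* (root r) y k ⟨
        (root r * y) ^ k     ≈⟨ ^-cong k xy≋1 ⟩
        1ℤ ^ k               ≡⟨ ^-zeroˡ k ⟩
        1ℤ                   ∎

    translate : ∀ {c} → Residue c → Fin m → Fin m
    translate rc j = index (residue-* rc (α-residue j))

    translate-spec : ∀ {c} (rc : Residue c) j → α (translate rc j) ≋ c * α j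
    translate-spec rc j = α-index (residue-* rc (α-residue j))

    translate-inverse : ∀ {c b} (rc : Residue c) (rb : Residue b) → c * b ≋ 1ℤ →
                        ∀ j → translate rc (translate rb j) ≡ j
    translate-inverse {c} {b} rc rb cb≋1 j = injective _ _ (begin
      α (translate rc (translate rb j))  ≈⟨ translate-spec rc (translate rb j) ⟩
      c * α (translate rb j)             ≈⟨ *-congˡ c (translate-spec rb j) ⟩
      c * (b * α j)                      ≡⟨ *-assoc c b (α j) ⟨
      c * b * α j                        ≈⟨ *-congʳ (α j) cb≋1 ⟩
      1ℤ * α j                           ≡⟨ *-identityˡ (α j) ⟩
      α j                                ∎)
      where open ≋-Reasoning

    residue-permutation : ∀ {c} → Residue c → ∃[ π ] (∀ j → α (π ⟨$⟩ʳ j) ≋ c * α j)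
    residue-permutation {c} rc = let b , rb , cb≋1 = residue-inverse rc in
      permutation (translate rc) (translate rb)
        (translate-inverse rc rb cb≋1)
        (translate-inverse rb rc (≋-trans (reflexive (*-comm b c)) cb≋1))
      , translate-spec rc

    -- Multiplication by c permutes the residues and hence fixes their product modulo p; that
    -- product is prime to p and can be cancelled.
    lagrange : ∀ {c} → Residue c → c ^ m ≋ 1ℤ
    lagrange {c} rc = *-cancelʳ {prod α} (∤-prod α (λ i → non-multiple (α-residue i))) (begin
      c ^ m * prod α             ≡⟨ prod-scale c α ⟨
      prod (λ j → c * α j)       ≈⟨ prod-cong-≋ (proj₂ (residue-permutation rc)) ⟨
      prod (λ j → α (π ⟨$⟩ʳ j))  ≡⟨ prod-permute α π ⟨
      prod α                     ≡⟨ *-identityˡ (prod α) ⟨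
      1ℤ * prod α                ∎)
      where
      open ≋-Reasoning
      π = proj₁ (residue-permutation rc)

    module _ {c : ℤ} (π : Permutation′ m) (spec : ∀ j → α (π ⟨$⟩ʳ j) ≋ c * α j)
             (s : ℤ) (permuted : ∀ A → det (λ i j → A i (π ⟨$⟩ʳ j)) ≡ s * det A) where

      -- The sign of multiplication by c is read off from its effect on the Vandermonde matrix.
      multiplier : s ≋ powers c m
      multiplier = *-cancelʳ {det (vandermonde α)} (vandermonde-nonsingular α injective) (begin
        s * det (vandermonde α)                      ≡⟨ permuted (vandermonde α) ⟨
        det (λ r j → α (π ⟨$⟩ʳ j) ^ toℕ r)           ≈⟨ det-cong-≋ entries ⟩
        det (λ r j → c ^ toℕ r * vandermonde α r j)  ≡⟨ det-scaleRows (λ r → c ^ toℕ r) (vandermonde α) ⟩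
        powers c m * det (vandermonde α)             ∎)
        where
        open ≋-Reasoning
        entries : ∀ r j → α (π ⟨$⟩ʳ j) ^ toℕ r ≋ c ^ toℕ r * α j ^ toℕ r
        entries r j = ≋-trans (^-cong (toℕ r) (spec j)) (reflexive (^-distrib-* c (α j) (toℕ r)))

      -- The sign of the permutation is c^(2h² - h), so the factor cʰ completes it to the square of
      -- c^(h²).
      twisted-skew-square : ∀ h → m ≡ h ℕ.* 2 → (B : Matrix m) → Skew B →
                            IsSquare (det (λ i j → B i (π ⟨$⟩ʳ j)) * c ^ h)
      twisted-skew-square h m≡2h B skew = square-resp (≋-sym identity)
        (square-* {Q * Q} (Q , ≋-refl) (det-square m≡2h B skew))
        where
        open ≋-Reasoning
        Q = c ^ (h ℕ.* h)
        -- Quantifying over the size anew lets the equation be matched.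
        det-square : ∀ {m} → m ≡ h ℕ.* 2 → (B : Matrix m) → Skew B → IsSquare (det B)
        det-square refl = skew-det-square h
        lemma : ∀ s b c → s * b * c ≡ s * c * b
        lemma = solve-∀
        identity : det (λ i j → B i (π ⟨$⟩ʳ j)) * c ^ h ≋ Q * Q * det B
        identity = begin
          det (λ i j → B i (π ⟨$⟩ʳ j)) * c ^ h   ≡⟨ cong (_* c ^ h) (permuted B) ⟩
          s * det B * c ^ h                      ≈⟨ *-congʳ (c ^ h) (*-congʳ (det B) multiplier) ⟩
          powers c m * det B * c ^ h             ≡⟨ lemma (powers c m) (det B) (c ^ h) ⟩
          powers c m * c ^ h * det B             ≡⟨ cong (λ m → powers c m * c ^ h * det B) m≡2h ⟩
          powers c (h ℕ.* 2) * c ^ h * det B     ≡⟨ cong (_* det B) (powers-double c h) ⟩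
          Q * Q * det B                          ∎

    module _ (h : ℕ) (m≡2h : m ≡ h ℕ.* 2) where

      det-powers-square : ∀ n d → 2 ℕ∣.∤ n → Residue (- d) →
        IsSquare (det (λ i j → (α i + d * α j) ^ n) * (- d) ^ h)
      det-powers-square n d 2∤n r-d = square-resp (*-congʳ ((- d) ^ h) (≋-sym (det-cong-≋ entry)))
        (twisted-skew-square π spec (proj₁ (det-permuteColumns π)) (proj₂ (det-permuteColumns π)) h m≡2h B B-skew)
        where
        open ≋-Reasoning
        π = proj₁ (residue-permutation r-d)
        spec = proj₂ (residue-permutation r-d)
        B : Matrix m
        B i j = (α i - α j) ^ n
        B-skew : Skew B
        B-skew i j = trans (cong (_^ n) (lemma (α i) (α j)))
          (subst (λ n → (- (α j - α i)) ^ n ≡ - ((α j - α i) ^ n)) (sym (proj₂ (odd-half 2∤n)))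
            (neg-^-odd (α j - α i) (proj₁ (odd-half 2∤n))))
          where
          lemma : ∀ a b → a - b ≡ - (b - a)
          lemma = solve-∀
        entry : ∀ i j → (α i + d * α j) ^ n ≋ B i (π ⟨$⟩ʳ j)
        entry i j = ^-cong n (begin
          α i + d * α j           ≡⟨ lemma (α i) d (α j) ⟩
          α i + - (- d * α j)     ≈⟨ +-cong (≋-refl {α i}) (neg-cong (spec j)) ⟨
          α i - α (π ⟨$⟩ʳ j)      ∎)
          where
          lemma : ∀ a d b → a + d * b ≡ a + - (- d * b)
          lemma = solve-∀

      -- The square of cʰ is cᵐ, which is 1 by `lagrange`.
      ^h-sign : ∀ {c} → Residue c → c ^ h ≋ 1ℤ ⊎ c ^ h ≋ -1ℤ
      ^h-sign {c} rc = square-root-of-1 (≋-trans (reflexive (trans (sym (^-double c h)) (cong (c ^_) (sym m≡2h)))) (lagrange rc))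

      0<2h : .{{_ : ℕ.NonZero h}} → 0 ℕ.< m
      0<2h = subst (0 ℕ.<_) (sym m≡2h) (ℕ.*-mono-< {0} {h} {0} {2} (ℕ.>-nonZero⁻¹ h) (s≤s z≤n))

      h<2h : .{{_ : ℕ.NonZero h}} → h ℕ.< m
      h<2h = subst (h ℕ.<_) (sym m≡2h) (ℕ.m<m*n h 2 (s≤s (s≤s z≤n)))

      -- If αʰ ≡ 1 for all residues α, rows 0 and h of the Vandermonde matrix coincide modulo p.
      residue-neg1 : .{{_ : ℕ.NonZero h}} → Residue -1ℤ
      residue-neg1 = decide (any? λ i → ¬? (+ p ∣? (α i ^ h - 1ℤ)))
        where
        open ≋-Reasoning
        0≢h : fromℕ< 0<2h ≢ fromℕ< h<2h
        0≢h eq = ℕ.<⇒≢ (ℕ.>-nonZero⁻¹ h) (fromℕ<-injective _ _ 0<2h h<2h eq)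
        neg1 : ∀ i → ¬ (+ p ∣ α i ^ h - 1ℤ) → α i ^ h ≋ 1ℤ ⊎ α i ^ h ≋ -1ℤ → Residue -1ℤ
        neg1 i αʰ≢1 (inj₁ αʰ≋1)  = ⊥-elim (αʰ≢1 (modulus∣ αʰ≋1))
        neg1 i αʰ≢1 (inj₂ αʰ≋-1) = residue-resp αʰ≋-1 (residue-^ h (α-residue i))
        coincide : (∀ i → α i ^ h ≋ 1ℤ) → ∀ l → vandermonde α (fromℕ< 0<2h) l ≋ vandermonde α (fromℕ< h<2h) l
        coincide αʰ≋1 l = begin
          α l ^ toℕ (fromℕ< 0<2h)  ≡⟨ cong (α l ^_) (toℕ-fromℕ< 0<2h) ⟩
          1ℤ                       ≈⟨ αʰ≋1 l ⟨
          α l ^ h                  ≡⟨ cong (α l ^_) (toℕ-fromℕ< h<2h) ⟨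
          α l ^ toℕ (fromℕ< h<2h)  ∎
        decide : Dec (∃[ i ] ¬ (+ p ∣ α i ^ h - 1ℤ)) → Residue -1ℤ
        decide (yes (i , αʰ≢1)) = neg1 i αʰ≢1 (^h-sign (α-residue i))
        decide (no all)         = ⊥-elim (vandermonde-nonsingular α injective
          (det-alternating-≋ (vandermonde α) (fromℕ< 0<2h) (fromℕ< h<2h) 0≢h (coincide λ i →
            mod (decidable-stable (+ p ∣? (α i ^ h - 1ℤ)) λ αʰ≢1 → all (i , αʰ≢1)))))

  -- The kernel of a character of order k

  ∣-resp-mod : ∀ {g N e f} → + g ∣ + N → e ≡ f [mod N ] → + g ∣ f → + g ∣ e
  ∣-resp-mod {g} {N} {e} {f} g∣N N∣e-f g∣f = subst (+ g ∣_) (lemma e f) (∣m∣n⇒∣m+n (∣-trans g∣N N∣e-f) g∣f)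
    where
    lemma : ∀ e f → e - f + f ≡ e
    lemma = solve-∀

  module CharacterKernel
    {p : ℕ} (p-prime : Prime p) (k m : ℕ) .{{_ : ℕ.NonZero k}} (m*k≡p-1 : m ℕ.* k ≡ p ∸ 1)
    (α : Fin m → ℤ) (residue : ∀ i → IsNonzeroPowerResidue k p (α i))
    (distinct : ∀ i j → α i ≡ α j [mod p ] → i ≡ j)
    (complete : ∀ a → IsNonzeroPowerResidue k p a → ∃[ i ] (α i ≡ a [mod p ]))
    (χ : ℤ → Value) (χ-character : IsCharacter p χ) (χ-order : HasOrder p χ k)
    where

    open PrimeCongruence p-prime
    open PowerResidues p-prime k m m*k≡p-1 α residue distinct complete
    open IsCharacter χ-character
    open HasOrder χ-order

    private instance
      p-nonZero : ℕ.NonZero p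
      p-nonZero = prime⇒nonZero p-prime

    N : ℕ
    N = p ∸ 1

    module Exponent = Congruence N
    open Exponent using () renaming (_≋_ to _≋ᴺ_; mod to modᴺ; modulus∣ to modulusᴺ∣)

    -- This says χ(a) = exp(2πi e/N). The stored `exponent` is the integer that χ returns, `e` any
    -- integer congruent to it, so that logarithms can be replaced modulo N.
    record Log (a e : ℤ) : Set where
      constructor log
      field
        {exponent} : ℤ
        χ≡         : χ a ≡ just exponent
        exponent≋  : exponent ≋ᴺ e

    log-from-≈ : ∀ {a e} → χ a ≈ just e [ζ N ] → Log a e
    log-from-≈ {a} χa≈ with χ a in eq | χa≈
    ... | just f | just N∣ = log eq (modᴺ N∣)

    log-resp : ∀ {a e f} → e ≋ᴺ f → Log a e → Log a f
    log-resp e≋f (log χ≡ f≋) = log χ≡ (Exponent.≋-trans f≋ e≋f)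

    log-exists : ∀ {a} → ¬ + p ∣ a → ∃[ e ] Log a e
    log-exists {a} p∤a with χ a in eq
    ... | just e  = e , log eq Exponent.≋-refl
    ... | nothing = ⊥-elim (p∤a (Equivalence.to (vanishing a) (subst (λ v → v ≈ 0ᵛ [ζ N ]) (sym eq) nothing)))

    log-unique : ∀ {a e f} → Log a e → Log a f → e ≋ᴺ f
    log-unique (log χ≡₁ e≋) (log χ≡₂ f≋) with trans (sym χ≡₁) χ≡₂
    ... | refl = Exponent.≋-trans (Exponent.≋-sym e≋) f≋

    log-cong : ∀ {a b e} → a ≋ b → Log a e → Log b e
    log-cong {a} {b} a≋b (log χ≡ e≋) = log-resp e≋
      (log-from-≈ (subst (λ v → χ b ≈ v [ζ N ]) χ≡ (periodic b a (modulus∣ (≋-sym a≋b)))))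

    log-* : ∀ {a b e f} → Log a e → Log b f → Log (a * b) (e + f)
    log-* {a} {b} (log χa≡ e≋) (log χb≡ f≋) = log-resp (Exponent.+-cong e≋ f≋)
      (log-from-≈ (subst₂ (λ u v → χ (a * b) ≈ u · v [ζ N ]) χa≡ χb≡ (multiplicative a b)))

    -- Since 1 · 1 = 1, the exponent e of χ(1) satisfies e + e ≡ e.
    log-1 : Log 1ℤ 0ℤ
    log-1 with log-exists ∤1
    ... | e , le = log-resp (begin
      e            ≡⟨ lemma e ⟩
      e + e - e    ≈⟨ Exponent.+-cong (log-unique (log-* le le) le) (Exponent.≋-refl { - e}) ⟩
      e - e        ≡⟨ self e ⟩
      0ℤ           ∎) le
      where
      open Exponent.≋-Reasoning
      lemma : ∀ e → e ≡ e + e - e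
      lemma = solve-∀
      self : ∀ e → e - e ≡ 0ℤ
      self = solve-∀

    log-^ : ∀ {a e} n → Log a e → Log (a ^ n) (+ n * e)
    log-^ {a} {e} zero    la = log-resp (Exponent.reflexive (sym (*-zeroˡ e))) log-1
    log-^ {a} {e} (suc n) la = log-resp (Exponent.reflexive (lemma e (+ n))) (log-* la (log-^ n la))
      where
      lemma : ∀ e n → e + n * e ≡ (1ℤ + n) * e
      lemma = solve-∀

    log-power-trivial : ∀ {a e} → ¬ + p ∣ a → Log a e → + k * e ≋ᴺ 0ℤ
    log-power-trivial {a} p∤a (log χ≡ e≋) with subst (λ v → v ^ᵛ k ≈ 1ᵛ [ζ N ]) χ≡ (trivial a p∤a)
    ... | just N∣ = Exponent.≋-trans (Exponent.*-congˡ (+ k) (Exponent.≋-sym e≋)) (modᴺ N∣)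

    -- The exponents of χ on the units: a subgroup of ℤ containing N. The following lemmas look for
    -- its positive generator.
    Image : ℤ → Set
    Image e = ∃[ a ] ¬ (+ p ∣ a) × Log a e

    image-+ : ∀ {e f} → Image e → Image f → Image (e + f)
    image-+ (a , p∤a , la) (b , p∤b , lb) = a * b , ∤-* p∤a p∤b , log-* la lb

    image-neg : ∀ {e} → Image e → Image (- e)
    image-neg {e} (a , p∤a , la) with inverse p∤a
    ... | b , ab≋1 with log-exists (∤-unitʳ {a} ab≋1)
    ...   | f , lb = b , ∤-unitʳ {a} ab≋1 , log-resp (begin
      f             ≡⟨ lemma e f ⟩
      e + f - e     ≈⟨ Exponent.+-cong (log-unique (log-cong ab≋1 (log-* la lb)) log-1) (Exponent.≋-refl { - e}) ⟩
      0ℤ - e        ≡⟨ +-identityˡ (- e) ⟩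
      - e           ∎) lb
      where
      open Exponent.≋-Reasoning
      lemma : ∀ e f → f ≡ e + f - e
      lemma = solve-∀

    image-scale : ∀ {e} n → Image e → Image (+ n * e)
    image-scale n (a , p∤a , la) = a ^ n , ∤-^ n p∤a , log-^ n la

    image-abs : ∀ {e} → Image e → Image (+ abs e)
    image-abs {+ n}      im = im
    image-abs { -[1+ n ]} im = image-neg im

    image-gcd : ∀ {g e} → Image (+ g) → Image e → ∃[ d ] Image (+ d) × d ℕ∣.∣ g × d ℕ∣.∣ abs e
    image-gcd {g} {e} im-g im-e with Bézout.lemma g (abs e)
    ... | Bézout.result d (GCD.is (d∣g , d∣e) _) identity = d , helper identity , d∣g , d∣e
      where
      cast : ∀ u v w z → d ℕ.+ u ℕ.* v ≡ w ℕ.* z → + w * + z + - (+ u * + v) ≡ + d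
      cast u v w z eq = trans (cong₂ (λ a b → a + - b) (trans (sym (pos-* w z)) (cong (λ n → + n) (sym eq))) (sym (pos-* u v)))
        (lemma (+ d) (+ (u ℕ.* v)))
        where
        lemma : ∀ a b → a + b + - b ≡ a
        lemma = solve-∀
      helper : Bézout.Identity d g (abs e) → Image (+ d)
      helper (Bézout.+- x y eq) = subst Image (cast y (abs e) x g eq)
        (image-+ (image-scale x im-g) (image-neg (image-scale y (image-abs im-e))))
      helper (Bézout.-+ x y eq) = subst Image (cast x g y (abs e) eq)
        (image-+ (image-scale y (image-abs im-e)) (image-neg (image-scale x im-g)))

    N≋0 : 0ℤ ≋ᴺ + N
    N≋0 = modᴺ (divides -1ℤ (lemma (+ N)))
      where
      lemma : ∀ n → 0ℤ - n ≡ -1ℤ * n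
      lemma = solve-∀

    -- The generator is accumulated as the gcd of N with one exponent of χ(a) for each a below `t`
    -- prime to p. Divisibility passes to every other exponent of the same a because the gcd divides
    -- N.
    image-gcd-upTo : ∀ t → ∃[ g ] Image (+ g) × + g ∣ + N ×
      (∀ a → a ℕ.< t → ¬ + p ∣ + a → ∀ e → Log (+ a) e → + g ∣ e)
    -- The initial value N is an exponent of χ(1), because N ≡ 0.
    image-gcd-upTo zero = N , (1ℤ , ∤1 , log-resp N≋0 log-1) , ∣-refl , λ a ()
    image-gcd-upTo (suc t) with image-gcd-upTo t | + p ∣? + t
    ... | g , im-g , g∣N , below | yes p∣t = g , im-g , g∣N , helper
      where
      helper : ∀ a → a ℕ.< suc t → ¬ + p ∣ + a → ∀ e → Log (+ a) e → + g ∣ e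
      helper a a<1+t p∤a e with ℕ.m≤n⇒m<n∨m≡n (ℕ.≤-pred a<1+t)
      ... | inj₁ a<t  = below a a<t p∤a e
      ... | inj₂ refl = ⊥-elim (p∤a p∣t)
    ... | g , im-g , g∣N , below | no p∤t with log-exists p∤t
    ...   | f , lf with image-gcd im-g (+ t , p∤t , lf)
    ...     | d , im-d , d∣g , d∣f = d , im-d , d∣N , helper
      where
      d∣N : + d ∣ + N
      d∣N = ∣-trans (∣ᵤ⇒∣ d∣g) g∣N
      helper : ∀ a → a ℕ.< suc t → ¬ + p ∣ + a → ∀ e → Log (+ a) e → + d ∣ e
      helper a a<1+t p∤a e la with ℕ.m≤n⇒m<n∨m≡n (ℕ.≤-pred a<1+t)
      ... | inj₁ a<t  = ∣-trans (∣ᵤ⇒∣ d∣g) (below a a<t p∤a e la)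
      ... | inj₂ refl = ∣-resp-mod d∣N (modulusᴺ∣ (log-unique la lf)) (∣ᵤ⇒∣ d∣f)

    N>0 : 0 ℕ.< N
    N>0 = ℕ.m<n⇒0<n∸m (ℕ.nonTrivial⇒n>1 p {{prime⇒nonTrivial p-prime}})

    image-divisor : ∃[ g ] Image (+ g) × + g ∣ + N × (∀ {a e} → ¬ + p ∣ a → Log a e → + g ∣ e)
    image-divisor = let g , im-g , g∣N , below = image-gcd-upTo p in
      g , im-g , g∣N , λ {a} {e} p∤a la →
        below (a %ℕ p) (n%ℕd<d a p) (λ p∣ → p∤a (∣-resp-≋ (≋-sym (%ℕ-≋ a)) p∣)) e (log-cong (%ℕ-≋ a) la)

    multiples-power-trivial : ∀ {g q} → N ≡ q ℕ.* g → (∀ {a e} → ¬ + p ∣ a → Log a e → + g ∣ e) →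
                              IsPowerTrivial p χ q
    multiples-power-trivial {g} {q} N≡qg g∣log a p∤a = helper (log-exists p∤a)
      where
      N∣qf : ∀ {f} → + g ∣ f → + q * f ≡ 0ℤ [mod N ]
      N∣qf {f} (divides z f≡zg) = divides z (begin
        + q * f - 0ℤ         ≡⟨ cong (λ f → + q * f - 0ℤ) f≡zg ⟩
        + q * (z * + g) - 0ℤ ≡⟨ lemma (+ q) z (+ g) ⟩
        z * (+ q * + g)      ≡⟨ cong (z *_) (pos-* q g) ⟨
        z * + (q ℕ.* g)      ≡⟨ cong (λ n → z * + n) N≡qg ⟨
        z * + N              ∎)
        where
        open ≡-Reasoning
        lemma : ∀ q z g → q * (z * g) - 0ℤ ≡ z * (q * g)
        lemma = solve-∀
      helper : ∃[ e ] Log a e → χ a ^ᵛ q ≈ 1ᵛ [ζ N ]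
      helper (e , log {f} χ≡ _) = subst (λ v → v ^ᵛ q ≈ 1ᵛ [ζ N ]) (sym χ≡)
        (just (N∣qf {f} (g∣log p∤a (log χ≡ Exponent.≋-refl))))

    -- The divisibility gives N ≤ k g and the minimality of k gives k g ≤ q g = N; so k g = N = m k.
    -- A zero factor is excluded by N > 0.
    quotient-unique : ∀ g q → N ≡ q ℕ.* g → N ℕ∣.∣ k ℕ.* g → (1 ℕ.≤ q → k ℕ.≤ q) → g ≡ m
    quotient-unique zero    q       N≡qg _ _ = ⊥-elim (ℕ.<⇒≢ N>0 (sym (trans N≡qg (ℕ.*-zeroʳ q))))
    quotient-unique (suc g) zero    N≡qg _ _ = ⊥-elim (ℕ.<⇒≢ N>0 (sym N≡qg))
    quotient-unique (suc g) (suc q) N≡qg N∣kg k≤q =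
      ℕ.*-cancelʳ-≡ (suc g) m k (trans (ℕ.*-comm (suc g) k) (trans kg≡N (sym m*k≡p-1)))
      where
      kg≡N : k ℕ.* suc g ≡ N
      kg≡N = ℕ.≤-antisym
        (ℕ.≤-trans (ℕ.*-monoˡ-≤ (suc g) (k≤q (s≤s z≤n))) (ℕ.≤-reflexive (sym N≡qg)))
        (ℕ∣.∣⇒≤ {{ℕ.m*n≢0 k (suc g)}} N∣kg)

    -- Because m/N = 1/k, some value of χ is the primitive root of unity exp(2πi/k). If g generates
    -- the exponents and N = q g, then χ to the power q is trivial, which forces g = m by the
    -- minimality of k.
    generator : Image (+ m)
    generator = helper image-divisor
      where
      helper : ∃[ g ] Image (+ g) × + g ∣ + N × (∀ {a e} → ¬ + p ∣ a → Log a e → + g ∣ e) → Image (+ m)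
      helper (g , im-g , g∣N , g∣log) = subst (λ n → Image (+ n)) (g≡m (∣⇒∣ᵤ g∣N)) im-g
        where
        N∣kg : N ℕ∣.∣ k ℕ.* g
        N∣kg = subst (N ℕ∣.∣_) (abs-* (+ k) (+ g))
          (∣⇒∣ᵤ (Exponent.≋0⇒∣ (log-power-trivial (proj₁ (proj₂ im-g)) (proj₂ (proj₂ im-g)))))
        g≡m : g ℕ∣.∣ N → g ≡ m
        g≡m (ℕ∣.divides q N≡qg) = quotient-unique g q N≡qg N∣kg λ q≥1 →
          minimal q q≥1 (multiples-power-trivial {g} {q} N≡qg g∣log)

    -- If a ≡ xᵏ, then χ(a) = χ(x)ᵏ = 1.
    log-residue : ∀ {a} → Residue a → Log a 0ℤ
    log-residue r = let e , lx = log-exists (root-non-multiple r) in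
      log-resp (log-power-trivial (root-non-multiple r) lx) (log-cong (root^k r) (log-^ k lx))

    m-nonZero : ℕ.NonZero m
    m-nonZero = ℕ.m*n≢0⇒m≢0 m {{subst ℕ.NonZero (sym m*k≡p-1) (ℕ.>-nonZero N>0)}}

    -- As N = k m, cancelling m turns the congruence modulo N into one modulo k.
    multiples-distinct : ∀ {i j} → i ℕ.< k → j ℕ.< k → + i * + m ≋ᴺ + j * + m → i ≡ j
    multiples-distinct {i} {j} i<k j<k (modᴺ N∣) = residues-equal i<k j<k
      (*-cancelʳ-∣ (+ m) {{m-nonZero}} (subst₂ _∣_ km≡N (lemma (+ i) (+ j) (+ m)) N∣))
      where
      km≡N : + N ≡ + k * + m
      km≡N = trans (cong (λ n → + n) (trans (sym m*k≡p-1) (ℕ.*-comm m k))) (pos-* k m)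
      lemma : ∀ i j m → i * m - j * m ≡ (i - j) * m
      lemma = solve-∀

    log-nonzero : ∀ {a e} → Log a e → ¬ + p ∣ a
    log-nonzero {a} (log χ≡ _) p∣a with subst (λ v → v ≈ 0ᵛ [ζ N ]) χ≡ (Equivalence.from (vanishing a) p∣a)
    ... | ()

    %ℕ-injective : ∀ {a b} → fromℕ< (n%ℕd<d a p) ≡ fromℕ< (n%ℕd<d b p) → a ≋ b
    %ℕ-injective {a} {b} eq = ≋-trans (%ℕ-≋ a) (≋-trans
      (reflexive (cong (λ n → + n) (fromℕ<-injective (a %ℕ p) (b %ℕ p) (n%ℕd<d a p) (n%ℕd<d b p) eq)))
      (≋-sym (%ℕ-≋ b)))

    -- The products αᵢ gʲ with j < k already fill all p − 1 nonzero classes.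
    module _ {g : ℤ} (p∤g : ¬ + p ∣ g) (log-g : Log g (+ m)) where

      representative : Fin m → Fin k → ℤ
      representative i j = α i * g ^ toℕ j

      log-representative : ∀ i j → Log (representative i j) (+ toℕ j * + m)
      log-representative i j = log-resp (Exponent.reflexive (+-identityˡ (+ toℕ j * + m)))
        (log-* (log-residue (α-residue i)) (log-^ (toℕ j) log-g))

      -- χ ignores αᵢ and sees only the exponent j m, which determines j; then gʲ cancels.
      representative-injective : ∀ i j i′ j′ → representative i j ≋ representative i′ j′ → i ≡ i′ × j ≡ j′
      representative-injective i j i′ j′ eq = injective i i′ (*-cancelʳ {g ^ toℕ j} (∤-^ {g} (toℕ j) p∤g)
          (≋-trans eq (reflexive (cong (λ j → α i′ * g ^ toℕ j) (sym j≡j′))))) , j≡j′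
        where
        j≡j′ : j ≡ j′
        j≡j′ = toℕ-injective (multiples-distinct (toℕ<n j) (toℕ<n j′)
          (log-unique (log-cong eq (log-representative i j)) (log-representative i′ j′)))

      kernel-representative : ∀ {d} → Log d 0ℤ → ∀ i j → d ≋ representative i j → d ≋ α i
      kernel-representative {d} log-d i j eq = ≋-trans eq
        (reflexive (trans (cong (λ j → α i * g ^ j) (sym j≡0)) (*-identityʳ (α i))))
        where
        j≡0 : 0 ≡ toℕ j
        j≡0 = multiples-distinct (ℕ.>-nonZero⁻¹ k) (toℕ<n j)
          (Exponent.≋-trans (Exponent.reflexive (*-zeroˡ (+ m)))
            (log-unique (log-cong eq log-d) (log-representative i j)))

      module _ {d : ℤ} (log-d : Log d 0ℤ) where

        row : Fin (m ℕ.* k) → Fin m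
        row x = proj₁ (remQuot {m} k x)

        column : Fin (m ℕ.* k) → Fin k
        column x = proj₂ (remQuot {m} k x)

        row-column-injective : ∀ x y → row x ≡ row y × column x ≡ column y → x ≡ y
        row-column-injective x y (eq₁ , eq₂) = trans (sym (combine-remQuot {m} k x))
          (trans (cong₂ combine eq₁ eq₂) (combine-remQuot {m} k y))

        -- These are p + 1 integers, so two of them agree modulo p.
        family : Fin (2 ℕ.+ m ℕ.* k) → ℤ
        family zero          = 0ℤ
        family (suc zero)    = d
        family (suc (suc x)) = representative (row x) (column x)

        -- Zero meets no other member, and representatives do not meet each other. So d meets a
        -- representative, and χ(d) = 1 leaves only j = 0, that is, one of the αᵢ.
        collision : ∀ x y → toℕ x ℕ.< toℕ y → family x ≋ family y → Residue d
        collision zero          zero          () _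
        collision zero          (suc zero)    _  0≋d = ⊥-elim (log-nonzero log-d (≋0⇒∣ (≋-sym 0≋d)))
        collision zero          (suc (suc y)) _  0≋c =
          ⊥-elim (log-nonzero (log-representative (row y) (column y)) (≋0⇒∣ (≋-sym 0≋c)))
        collision (suc zero)    (suc zero)    (s≤s ()) _
        collision (suc zero)    (suc (suc y)) _  d≋c =
          residue-resp (≋-sym (kernel-representative log-d (row y) (column y) d≋c)) (α-residue (row y))
        collision (suc (suc x)) (suc zero)    (s≤s ()) _
        collision (suc (suc x)) (suc (suc y)) x<y c≋c′ =
          ⊥-elim (ℕ.<⇒≢ x<y (cong (λ z → 2 ℕ.+ toℕ z) (row-column-injective x y
            (representative-injective (row x) (column x) (row y) (column y) c≋c′))))

        kernel-covered : Residue d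
        kernel-covered = let x , y , x<y , fx≡fy = pigeonhole p<2+N reduce in
          collision x y x<y (%ℕ-injective fx≡fy)
          where
          p<2+N : p ℕ.< 2 ℕ.+ m ℕ.* k
          p<2+N = s≤s (ℕ.≤-reflexive (trans (sym (ℕ.suc-pred p)) (cong suc (sym m*k≡p-1))))
          reduce : Fin (2 ℕ.+ m ℕ.* k) → Fin p
          reduce x = fromℕ< (n%ℕd<d (family x) p)

    kernel⊆residues : ∀ {d} → Log d 0ℤ → Residue d
    kernel⊆residues log-d = let g , p∤g , log-g = generator in kernel-covered p∤g log-g log-d

  -- Legendre symbols

  module LegendreSymbol {p : ℕ} (p-prime : Prime p) where

    open PrimeCongruence p-prime

    private instance
      p-nonZero : ℕ.NonZero p
      p-nonZero = prime⇒nonZero p-prime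

    -- Indexing by the value lets two symbols be compared by matching: cases with different
    -- constants are absurd at once.
    data LegendreView (a : ℤ) : ℤ → Set where
      multiple   : + p ∣ a → LegendreView a 0ℤ
      residue    : ¬ + p ∣ a → IsSquare a → LegendreView a 1ℤ
      nonresidue : ¬ + p ∣ a → ¬ IsSquare a → LegendreView a -1ℤ

    x²≡x*x : ∀ x → x ^ 2 ≡ x * x
    x²≡x*x x = cong (x *_) (*-identityʳ x)

    bounded-root : ∀ {a} → IsSquare a → ∃[ x ] (+ p ∣ (+ toℕ {p} x) ^ 2 - a)
    bounded-root {a} (y , a≋yy) = x , modulus∣ (begin
      (+ toℕ x) ^ 2       ≡⟨ x²≡x*x (+ toℕ x) ⟩
      + toℕ x * + toℕ x  ≡⟨ cong (λ n → + n * + n) (toℕ-fromℕ< (n%ℕd<d y p)) ⟩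
      + (y %ℕ p) * + (y %ℕ p) ≈⟨ *-cong (%ℕ-≋ y) (%ℕ-≋ y) ⟨
      y * y              ≈⟨ a≋yy ⟨
      a                   ∎)
      where
      open ≋-Reasoning
      x = fromℕ< (n%ℕd<d y p)

    legendre-view : ∀ a → LegendreView a (legendre a p)
    legendre-view a with + p ∣? a
    ... | yes p∣a = multiple p∣a
    ... | no  p∤a with any? {n = p} (λ x → + p ∣? ((+ toℕ x) ^ 2 - a))
    ...   | yes (x , p∣) = residue p∤a (+ toℕ x , ≋-sym (≋-trans (reflexive (sym (x²≡x*x (+ toℕ x)))) (mod p∣)))
    ...   | no ∄x        = nonresidue p∤a (∄x ∘ bounded-root)

    square⇒legendre≢-1 : ∀ {a} → IsSquare a → legendre a p ≢ -1ℤ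
    square⇒legendre≢-1 {a} sq = helper (legendre-view a)
      where
      helper : ∀ {l} → LegendreView a l → l ≢ -1ℤ
      helper (multiple _)         ()
      helper (residue _ _)        ()
      helper (nonresidue _ ¬sq) _ = ¬sq sq

    square-root-∤ : ∀ {a u} → a ≋ u * u → ¬ + p ∣ a → ¬ + p ∣ u
    square-root-∤ {a} {u} a≋uu p∤a p∣u = p∤a (∣-resp-≋ (≋-sym a≋uu) (∣n⇒∣m*n u p∣u))

    square-cancelʳ : ∀ {a u} → ¬ + p ∣ u → IsSquare (a * (u * u)) → IsSquare a
    square-cancelʳ {a} {u} p∤u sq = square-cancel {u} {a} p∤u (square-resp (reflexive (lemma a u)) sq)
      where
      lemma : ∀ a u → a * (u * u) ≡ u * u * a
      lemma = solve-∀

    -- If both symbols were 1, then a · (-d) would be -1 times a square prime to p, making -1 a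
    -- square. If both were -1, then d is no square, so -d is one, and it cancels to leave a as a
    -- square.
    legendre-distinct : ∀ {a d} → ¬ IsSquare -1ℤ → ¬ + p ∣ d → IsSquare (a * - d) →
                        IsSquare d ⊎ IsSquare (- d) → legendre a p ≢ legendre d p
    legendre-distinct {a} {d} ¬-1 p∤d (w , ad≋ww) d∨-d = helper (legendre-view a) (legendre-view d)
      where
      lemma : ∀ u x → -1ℤ * (u * x * (u * x)) ≡ u * u * - (x * x)
      lemma = solve-∀
      helper : ∀ {l l′} → LegendreView a l → LegendreView d l′ → l ≢ l′
      helper _                      (multiple p∣d)      _  = p∤d p∣d
      helper (multiple _)           (residue _ _)       ()
      helper (multiple _)           (nonresidue _ _)    ()
      helper (residue _ _)          (nonresidue _ _)    ()
      helper (nonresidue _ _)       (residue _ _)       ()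
      helper (residue p∤a (u , a≋)) (residue _ (x , d≋)) _ =
        ¬-1 (square-cancelʳ {u = u * x} (∤-* {u} {x} (square-root-∤ {a} {u} a≋ p∤a) (square-root-∤ {d} {x} d≋ p∤d))
          (w , ≋-trans (reflexive (lemma u x)) (≋-trans (*-cong (≋-sym a≋) (neg-cong (≋-sym d≋))) ad≋ww)))
      helper (nonresidue _ ¬a)      (nonresidue _ ¬d)   _ = [ ¬d , ¬a ∘ a-square ]′ d∨-d
        where
        double-neg : ∀ d → -1ℤ * - d ≡ d
        double-neg = solve-∀
        p∤-d : ¬ + p ∣ - d
        p∤-d p∣-d = p∤d (subst (+ p ∣_) (double-neg d) (∣n⇒∣m*n -1ℤ p∣-d))
        a-square : IsSquare (- d) → IsSquare a
        a-square (x , -d≋) = square-cancelʳ {u = x} (square-root-∤ { - d} {x} -d≋ p∤-d)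
          (w , ≋-trans (*-congˡ a (≋-sym -d≋)) ad≋ww)

  congruent⇒∣∸ : ∀ {M a b} → b ℕ.≤ a → + a ≡ + b [mod M ] → M ℕ∣.∣ a ∸ b
  congruent⇒∣∸ {M} {a} {b} b≤a M∣a-b = ∣⇒∣ᵤ (subst (+ M ∣_) (trans (m-n≡m⊖n a b) (⊖-≥ b≤a)) M∣a-b)

  1≢-1 : ∀ {p} (p-prime : Prime p) → 2 ℕ∣.∤ p → ¬ (1ℤ ≡ -1ℤ [mod p ])
  1≢-1 {p} p-prime 2∤p p∣2 = 2∤p (ℕ∣.∣-reflexive (ℕ.≤-antisym
    (ℕ.nonTrivial⇒n>1 p {{prime⇒nonTrivial p-prime}}) (ℕ∣.∣⇒≤ (∣⇒∣ᵤ p∣2))))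

  -- Deciding whether cʰ is a square

  module Squares
    {p : ℕ} (p-prime : Prime p) (k m : ℕ) .{{_ : ℕ.NonZero k}} (m*k≡p-1 : m ℕ.* k ≡ p ∸ 1)
    (α : Fin m → ℤ) (residue : ∀ i → IsNonzeroPowerResidue k p (α i))
    (distinct : ∀ i j → α i ≡ α j [mod p ] → i ≡ j)
    (complete : ∀ a → IsNonzeroPowerResidue k p a → ∃[ i ] (α i ≡ a [mod p ]))
    (h : ℕ) .{{_ : ℕ.NonZero h}} (m≡2h : m ≡ h ℕ.* 2)
    where

    open PrimeCongruence p-prime
    open PowerResidues p-prime k m m*k≡p-1 α residue distinct complete
    open LegendreSymbol p-prime hiding (residue)

    residue-neg : ∀ {d} → Residue d → Residue (- d)
    residue-neg {d} rd = residue-resp (reflexive (lemma d)) (residue-* (residue-neg1 h m≡2h) rd)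
      where
      lemma : ∀ d → -1ℤ * d ≡ - d
      lemma = solve-∀

    module _ {a c : ℤ} (rc : Residue c) (sq : IsSquare (a * c ^ h)) where

      -- For k = 2q the residue c ≡ xᵏ is the square of x^q, hence cʰ is a square prime to p.
      square-k-even : 2 ℕ∣.∣ k → IsSquare a
      square-k-even (ℕ∣.divides q k≡2q) = square-cancelʳ {u = u}
        (∤-^ h (∤-^ q (root-non-multiple rc)))
        (square-resp (*-congˡ a cʰ≋uu) sq)
        where
        x = root rc
        u = (x ^ q) ^ h
        open ≋-Reasoning
        cʰ≋uu : c ^ h ≋ u * u
        cʰ≋uu = begin
          c ^ h                 ≈⟨ ^-cong h (root^k rc) ⟨
          (x ^ k) ^ h           ≡⟨ cong (λ k → (x ^ k) ^ h) k≡2q ⟩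
          (x ^ (q ℕ.* 2)) ^ h     ≡⟨ cong (_^ h) (^-double x q) ⟩
          (x ^ q * x ^ q) ^ h  ≡⟨ ^-distrib-* (x ^ q) (x ^ q) h ⟩
          u * u                ∎

      square-h-even : ∀ q → h ≡ q ℕ.* 2 → IsSquare a
      square-h-even q h≡2q = square-cancelʳ {u = c ^ q} (∤-^ q (non-multiple rc))
        (square-resp (reflexive (cong (a *_) (trans (cong (c ^_) h≡2q) (^-double c q)))) sq)

      square-h-odd : ∀ q → h ≡ suc (q ℕ.* 2) → IsSquare (a * c)
      square-h-odd q h≡ = square-cancelʳ {u = c ^ q} (∤-^ q (non-multiple rc))
        (square-resp (reflexive (trans (cong (λ e → a * c ^ e) h≡)
          (trans (cong (λ z → a * (c * z)) (^-double c q)) (lemma a c (c ^ q))))) sq)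
        where
        lemma : ∀ a c u → a * (c * (u * u)) ≡ a * c * (u * u)
        lemma = solve-∀

    module _ (q : ℕ) (h≡ : h ≡ suc (q ℕ.* 2)) where

      -- For odd h the power d^(h+1) is a square, and it equals d · dʰ ≡ ±d.
      square-±d : ∀ {d} → Residue d → IsSquare d ⊎ IsSquare (- d)
      square-±d {d} rd = Sum.map (λ dʰ≋1 → d ^ suc q , square 1ℤ dʰ≋1 (*-identityʳ d))
                                 (λ dʰ≋-1 → d ^ suc q , square -1ℤ dʰ≋-1 (lemma d)) (^h-sign h m≡2h rd)
        where
        open ≋-Reasoning
        lemma : ∀ d → d * -1ℤ ≡ - d
        lemma = solve-∀
        square : ∀ s {e} → d ^ h ≋ s → d * s ≡ e → e ≋ d ^ suc q * d ^ suc q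
        square s {e} dʰ≋s ds≡e = begin
          e                      ≡⟨ ds≡e ⟨
          d * s                 ≈⟨ *-congˡ d dʰ≋s ⟨
          d * d ^ h             ≡⟨ cong (λ e → d ^ suc e) h≡ ⟩
          d ^ (suc q ℕ.* 2)        ≡⟨ ^-double d (suc q) ⟩
          d ^ suc q * d ^ suc q ∎

      neg1^odd : ∀ t → -1ℤ ^ suc (t ℕ.* 2) ≡ -1ℤ
      neg1^odd t = trans (neg-^-odd 1ℤ t) (cong -_ (^-zeroˡ (suc (t ℕ.* 2))))

      -- A square root y of −1 would give the residue yᵏ, whose m-th power is (−1)^(kh) = −1.
      neg1-nonsquare : 2 ℕ∣.∤ p → 2 ℕ∣.∤ k → ¬ IsSquare -1ℤ
      neg1-nonsquare 2∤p 2∤k (y , -1≋yy) = 1≢-1 p-prime 2∤p (modulus∣ (begin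
        1ℤ                  ≈⟨ lagrange yᵏ-residue ⟨
        (y ^ k) ^ m         ≡⟨ cong ((y ^ k) ^_) m≡2h ⟩
        (y ^ k) ^ (h ℕ.* 2)   ≡⟨ ^-double (y ^ k) h ⟩
        (y ^ k) ^ h * (y ^ k) ^ h ≡⟨ ^-distrib-* (y ^ k) (y ^ k) h ⟨
        (y ^ k * y ^ k) ^ h       ≡⟨ cong (_^ h) (^-distrib-* y y k) ⟨
        ((y * y) ^ k) ^ h         ≈⟨ ^-cong h (^-cong k -1≋yy) ⟨
        (-1ℤ ^ k) ^ h              ≡⟨ cong (_^ h) (trans (cong (-1ℤ ^_) (proj₂ (odd-half 2∤k))) (neg1^odd (proj₁ (odd-half 2∤k)))) ⟩
        -1ℤ ^ h                    ≡⟨ trans (cong (-1ℤ ^_) h≡) (neg1^odd q) ⟩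
        -1ℤ                 ∎))
        where
        open ≋-Reasoning
        p∤y : ¬ + p ∣ y
        p∤y = square-root-∤ { -1ℤ} {y} -1≋yy (non-multiple (residue-neg1 h m≡2h))
        yᵏ-residue : Residue (y ^ k)
        yᵏ-residue = residue-by (∤-^ k p∤y) y ≋-refl

-- The arithmetic of p, k and h, and the assembly of the cases

open import Data.Fin.Base using (Fin)
open import Data.Integer.Base as ℤ using (ℤ; +_; -_; -1ℤ; _^_)
open import Data.Nat.Base using (ℕ; suc; NonZero; _+_; _*_; _∸_; _/_; _≤_; _<_)
open import Data.Nat.Divisibility as ℕ∣ using (_∣_; _∤_)
open import Data.Nat.DivMod using (m*n/n≡m)
open import Data.Nat.Primality using (Prime; prime⇒nonZero; prime⇒nonTrivial)
import Data.Nat.Base as ℕ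
import Data.Nat.Properties as ℕ
import Data.Nat.Tactic.RingSolver as ℕ
open import Data.Product.Base using (_×_; _,_; ∃-syntax)
open import Relation.Binary.PropositionalEquality using (_≡_; _≢_; sym; trans; cong; subst)

theorem1p3 : (p k : ℕ) .{{_ : NonZero k}} →
    Prime p → 2 ∤ p →
    2 ≤ k → k ≤ (p ∸ 1) / 2 →
    2 * k + 1 < p → + p ≡ + 1 [mod 2 * k ] →
    (α : Fin ((p ∸ 1) / k) → ℤ) → RepresentsPowerResidues k p α →
    (χ : ℤ → Value) → IsCharacter p χ → HasOrder p χ k →
    (n : ℕ) → (p ∸ 1) / k + 1 ≤ n → n ≤ 2 * ((p ∸ 1) / k) ∸ 1 → 2 ∤ n →
    (d : ℤ) → χ d ≈ 1ᵛ [ζ p ∸ 1 ] →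
    (2 ∣ k → legendre (S n k d p α) p ≢ -1ℤ)
    ×
    (2 ∤ k →
    (+ p ≡ + 1 [mod 4 * k ] → legendre (S n k d p α) p ≢ -1ℤ)
    ×
    (+ p ≡ + (2 * k + 1) [mod 4 * k ] →
    legendre (S n k d p α) p ≢ legendre d p))
theorem1p3 p k p-prime 2∤p _ _ 2k+1<p p≡1 α represents χ χ-character χ-order n _ _ 2∤n d χd≈1 =
  (λ 2∣k → square⇒legendre≢-1 (square-k-even r-d sq 2∣k)) ,
  (λ 2∤k →
    (λ p≡1 → let q , h≡ = h-even p≡1 in square⇒legendre≢-1 (square-h-even r-d sq q h≡)) ,
    (λ p≡2k+1 → let q , h≡ = h-odd p≡2k+1 in
      legendre-distinct {d = d} (neg1-nonsquare q h≡ 2∤p 2∤k) (non-multiple rd)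
        (square-h-odd {a = S n k d p α} r-d sq q h≡) (square-±d q h≡ rd)))
  where
  open RepresentsPowerResidues represents
  instance
    p-nonZero : NonZero p
    p-nonZero = prime⇒nonZero p-prime
    p-1-nonZero : NonZero (p ∸ 1)
    p-1-nonZero = ℕ.>-nonZero (ℕ.m<n⇒0<n∸m (ℕ.nonTrivial⇒n>1 p {{prime⇒nonTrivial p-prime}}))
  p≥1 : 1 ≤ p
  p≥1 = ℕ.>-nonZero⁻¹ p
  m = (p ∸ 1) / k
  2k∣p-1 : 2 * k ∣ p ∸ 1
  2k∣p-1 = congruent⇒∣∸ p≥1 p≡1
  -- Here h = (p - 1)/(2k), half the number of residues.
  h = ℕ∣.quotient 2k∣p-1
  p-1≡2hk : p ∸ 1 ≡ h * 2 * k
  p-1≡2hk = trans (ℕ∣._∣_.equality 2k∣p-1) (sym (ℕ.*-assoc h 2 k))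
  m≡2h : m ≡ h * 2
  m≡2h = trans (cong (_/ k) p-1≡2hk) (m*n/n≡m (h * 2) k)
  m*k≡p-1 : m * k ≡ p ∸ 1
  m*k≡p-1 = trans (cong (_* k) m≡2h) (sym p-1≡2hk)
  instance
    h-nonZero : NonZero h
    h-nonZero = ℕ.m*n≢0⇒m≢0 h {2} {{ℕ.m*n≢0⇒m≢0 (h * 2) {k} {{subst NonZero p-1≡2hk p-1-nonZero}}}}
  half-unique : ∀ j → p ∸ 1 ≡ j * 2 * k → h ≡ j
  half-unique j p-1≡2jk = ℕ.*-cancelʳ-≡ h j 2 (ℕ.*-cancelʳ-≡ (h * 2) (j * 2) k (trans (sym p-1≡2hk) p-1≡2jk))
  h-even : + p ≡ + 1 [mod 4 * k ] → ∃[ q ] h ≡ q * 2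
  h-even p≡1 with congruent⇒∣∸ p≥1 p≡1
  ... | ℕ∣.divides t p-1≡4tk = t , half-unique (t * 2) (trans p-1≡4tk (lemma t k))
    where
    lemma : ∀ t k → t * (4 * k) ≡ t * 2 * 2 * k
    lemma = ℕ.solve-∀
  h-odd : + p ≡ + (2 * k + 1) [mod 4 * k ] → ∃[ q ] h ≡ suc (q * 2)
  h-odd p≡2k+1 with congruent⇒∣∸ (ℕ.<⇒≤ 2k+1<p) p≡2k+1
  -- From p - (2k + 1) = 4kt follows p - 1 = (2t + 1) · 2k, so h = 2t + 1.
  ... | ℕ∣.divides t rest≡4tk = t , half-unique (suc (t * 2)) (cong (_∸ 1) (trans
          (sym (ℕ.m∸n+n≡m (ℕ.<⇒≤ 2k+1<p))) (trans (cong (_+ (2 * k + 1)) rest≡4tk) (lemma t k))))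
    where
    lemma : ∀ t k → t * (4 * k) + (2 * k + 1) ≡ suc (suc (t * 2) * 2 * k)
    lemma = ℕ.solve-∀
  open PrimeCongruence p-prime using (IsSquare)
  open LegendreSymbol p-prime using (square⇒legendre≢-1; legendre-distinct)
  open PowerResidues p-prime k m m*k≡p-1 α residue distinct complete
  open CharacterKernel p-prime k m m*k≡p-1 α residue distinct complete χ χ-character χ-order
    using (kernel⊆residues; log-from-≈)
  open Squares p-prime k m m*k≡p-1 α residue distinct complete h m≡2h
  rd : Residue d
  rd = kernel⊆residues (log-from-≈ χd≈1)
  r-d : Residue (- d)
  r-d = residue-neg rd
  sq : IsSquare (S n k d p α ℤ.* (- d) ^ h)
  sq = det-powers-square h m≡2h n d 2∤n r-d
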